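{- For every proper minor-closed graph class $\mathcal{G}$ there exists a constant $c_{\mathcal{G}}$ such that every graph $G\in\mathcal{G}$ satisfies $\chi_{\mathrm{so}}(G)\leq c_{\mathcal{G}}$.
   Context: All graphs are finite and simple. A graph class is minor-closed if it is closed under taking minors, and proper if it is not the class of all graphs. A proper vertex-coloring $\varphi\colon V(G)\to[t]$ of a graph $G$ is \emph{strong odd} if for every vertex $v\in V(G)$ and every color $i\in[t]$ the number $|N(v)\cap\varphi^{ -1}(i)|$ is either zero or odd; $\chi_{\mathrm{so}}(G)$ is the minimum $t$ such that $G$ admits a strong odd coloring with $t$ colors. -}

module Defs where

open import Data.Nat using (ℕ; zero; suc; _+_; _*_; _≤_)
open import Data.Fin using (Fin)
open import Data.Fin.Properties using () renaming (_≟_ to _≟ᶠ_)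
open import Data.Bool using (Bool; true; false)
open import Data.Maybe using (Maybe; just)
open import Data.List using (List; length; filterᵇ; allFin)
open import Data.Product using (Σ; ∃; _×_; _,_)
open import Data.Sum using (_⊎_)
open import Relation.Binary.PropositionalEquality using (_≡_; _≢_)
open import Relation.Nullary using (¬_)
open import Relation.Nullary.Decidable using (⌊_⌋)
open import Data.Bool using (_∧_)

record Graph : Set where
  field
    n     : ℕ
    adj   : Fin n → Fin n → Bool
    sym   : ∀ u v → adj u v ≡ adj v u
    irrefl : ∀ v → adj v v ≡ false

open Graph public

data WalkIn (G : Graph) (S : Fin (n G) → Set) : Fin (n G) → Fin (n G) → Set where
  here : ∀ {u} → S u → WalkIn G S u u
  step : ∀ {u w v} → S u → adj G u w ≡ true → WalkIn G S w v → WalkIn G S u v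

-- H is a minor of G: a minor model assigns to each vertex of G at most one
-- vertex of H (so branch sets are pairwise disjoint); every branch set is
-- nonempty and induces a connected subgraph of G; every edge of H is
-- realized by an edge of G between the corresponding branch sets.
record MinorModel (H G : Graph) : Set where
  field
    branch    : Fin (n G) → Maybe (Fin (n H))
    nonempty  : ∀ h → ∃ λ g → branch g ≡ just h
    connected : ∀ h u v → branch u ≡ just h → branch v ≡ just h →
                WalkIn G (λ w → branch w ≡ just h) u v
    edges     : ∀ h h' → adj H h h' ≡ true →
                ∃ λ g → ∃ λ g' → branch g ≡ just h × branch g' ≡ just h' × adj G g g' ≡ true

IsMinor : Graph → Graph → Set
IsMinor H G = MinorModel H G

GraphClass : Set₁
GraphClass = Graph → Set

MinorClosed : GraphClass → Set
MinorClosed 𝒢 = ∀ G H → 𝒢 G → IsMinor H G → 𝒢 H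

Proper : GraphClass → Set
Proper 𝒢 = ∃ λ G → ¬ 𝒢 G

Odd : ℕ → Set
Odd m = ∃ λ k → m ≡ suc (2 * k)

colourCount : (G : Graph) {t : ℕ} → (Fin (n G) → Fin t) → Fin (n G) → Fin t → ℕ
colourCount G φ v i = length (filterᵇ (λ u → adj G v u ∧ ⌊ φ u ≟ᶠ i ⌋) (allFin (n G)))

IsStrongOddColouring : (G : Graph) (t : ℕ) → (Fin (n G) → Fin t) → Set
IsStrongOddColouring G t φ =
  (∀ u v → adj G u v ≡ true → φ u ≢ φ v) ×
  (∀ v i → colourCount G φ v i ≡ 0 ⊎ Odd (colourCount G φ v i))

-- χ_so(G) ≤ c : G admits a strong odd colouring with some t ≤ c colours
-- (χ_so(G) is the minimum such t, so this is exactly χ_so(G) ≤ c).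
χso≤ : Graph → ℕ → Set
χso≤ G c = ∃ λ t → t ≤ c × Σ (Fin (n G) → Fin t) (IsStrongOddColouring G t)

-- A class that misses H contains no graph with a clique minor of order t = |H|. All minors of such graphs are
-- sparse, so the edges can be oriented with bounded outdegrees. Join two vertices if they are adjacent, have a
-- common in-neighbour, or are the ends of a directed path of length two; the resulting graph is still sparse.
-- Order it degenerately and let κ be a greedy colouring of it. If the colouring refines κ and an out-neighbour of v
-- has colour i, then no other neighbour of v has, so only in-neighbours matter. The out-neighbours of b, sorted by
-- the order, form a list in which each entry leaves boundedly many candidates for the next one. Recording κ and
-- these choices gives b a label from a bounded set such that, among vertices with equal labels, the in-neighbours
-- of a fixed v are those whose lists share the same suffix starting at v. Agreement of the lists from position j on
-- is coarser the larger j is, and for a chain of boundedly many nested partitions there is a bounded colouring in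
-- which every class contains each of its colours an odd number of times.
module Submission where

open import Defs
open import Algebra.Properties.CommutativeSemigroup using (interchange)
open import Data.Bool using (Bool; _∧_; _∨_; false; if_then_else_; not; true)
open import Data.Bool.Properties using (¬-not; ∧-comm) renaming (_≟_ to _≟ᵇ_)
open import Data.Empty using (⊥-elim)
open import Data.Fin using (Fin; combine; suc; zero)
open import Data.Fin.Properties using (combine-injective; combine-injectiveʳ; combine-injectiveˡ) renaming (_≟_ to _≟ᶠ_; suc-injective to suc-injectiveᶠ)
open import Data.List using (List; []; _∷_; allFin; concatMap; drop; filter; filterᵇ; head; length; map)
open import Data.List.Membership.DecPropositional using () renaming (_∈?_ to member?)
open import Data.List.Membership.Propositional using (_∈_; _∉_; find; lose)
open import Data.List.Membership.Propositional.Properties using (∈-allFin; ∈-concatMap⁺; ∈-filter⁺; ∈-filter⁻; ∈-map⁺; ∈-∃++)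
open import Data.List.Properties using (length-++; length-map; length-tabulate; ∷-injectiveʳ; ∷-injectiveˡ) renaming (≡-dec to List-≡-dec)
open import Data.List.Relation.Binary.Permutation.Propositional using (_↭_; prep; refl; swap; ↭-sym; ↭⇒↭ₛ) renaming (trans to ↭-trans)
open import Data.List.Relation.Binary.Permutation.Propositional.Properties using (shift; ↭-length; ∈-resp-↭)
import Data.List.Relation.Binary.Permutation.Setoid.Properties as Permutationₛ
open import Data.List.Relation.Unary.All as All using (All; []; _∷_)
open import Data.List.Relation.Unary.AllPairs using (AllPairs; []; _∷_) renaming (head to AllPairs-head; tail to AllPairs-tail; zip to AllPairs-zip)
open import Data.List.Relation.Unary.AllPairs.Properties using () renaming (filter⁺ to AllPairs-filter⁺)
open import Data.List.Relation.Unary.Any using (any?; here; there)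
open import Data.List.Relation.Unary.Unique.Propositional using (Unique)
open import Data.List.Relation.Unary.Unique.Propositional.Properties using () renaming (allFin⁺ to Unique-allFin; filter⁺ to Unique-filter⁺)
open import Data.Maybe using (Maybe; just; nothing; _>>=_) renaming (map to mapᵐ)
open import Data.Maybe.Properties using (just-injective) renaming (≡-dec to Maybe-≡-dec)
open import Data.Nat using (_*_; _+_; _<_; _^_; _≤?_; _≤_; suc; s≤s; zero; z≤n; ℕ)
open import Data.Nat.ListAction using (sum)
open import Data.Nat.Properties
open import Data.Nat.Tactic.RingSolver using (solve-∀)
open import Data.Product using (∃; _×_; _,_; proj₁; proj₂)
open import Data.Product.Properties using () renaming (≡-dec to ×-≡-dec)
open import Data.Sum using (_⊎_; inj₁; inj₂; [_,_]′) renaming (swap to ⊎-swap)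
open import Function using (_∘_; flip)
open import Relation.Binary.Definitions using (DecidableEquality)
open import Relation.Binary.PropositionalEquality using (_≡_; _≢_; cong; cong₂; refl; setoid; subst; trans; module ≡-Reasoning) renaming (sym to ≡-sym)
open import Relation.Nullary using (Dec; contradiction; no; yes; ¬_)
open import Relation.Nullary.Decidable using (⌊_⌋)

private
  variable
    A : Set
    N : ℕ

-- Counting pairs in finite lists

+-interchange : ∀ a b c d → a + b + (c + d) ≡ a + c + (b + d)
+-interchange = interchange +-commutativeSemigroup

𝟙 : Bool → ℕ
𝟙 true  = 1
𝟙 false = 0

count : (A → Bool) → List A → ℕ
count p []       = 0
count p (x ∷ xs) = 𝟙 (p x) + count p xs

length-filterᵇ : (p : A → Bool) (xs : List A) → length (filterᵇ p xs) ≡ count p xs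
length-filterᵇ p [] = refl
length-filterᵇ p (x ∷ xs) with p x
... | true  = cong suc (length-filterᵇ p xs)
... | false = length-filterᵇ p xs

true≢false : {b : Bool} → b ≡ true → b ≢ false
true≢false refl ()

bool-ext : {a b : Bool} → (a ≡ true → b ≡ true) → (b ≡ true → a ≡ true) → a ≡ b
bool-ext {true}  {true}  f g = refl
bool-ext {true}  {false} f g = ≡-sym (f refl)
bool-ext {false} {true}  f g = g refl
bool-ext {false} {false} f g = refl

∧-true⁻ : {a b : Bool} → a ∧ b ≡ true → a ≡ true × b ≡ true
∧-true⁻ {true} {true} _ = refl , refl

∧-true⁺ : {a b : Bool} → a ≡ true → b ≡ true → a ∧ b ≡ true
∧-true⁺ refl refl = refl

∨-true⁻ : {a b : Bool} → a ∨ b ≡ true → a ≡ true ⊎ b ≡ true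
∨-true⁻ {true}  _ = inj₁ refl
∨-true⁻ {false} e = inj₂ e

∨-true⁺ˡ : {a b : Bool} → a ≡ true → a ∨ b ≡ true
∨-true⁺ˡ refl = refl

∨-true⁺ʳ : {a b : Bool} → b ≡ true → a ∨ b ≡ true
∨-true⁺ʳ {true}  refl = refl
∨-true⁺ʳ {false} refl = refl

not-true⁻ : {a : Bool} → not a ≡ true → a ≡ false
not-true⁻ {false} _ = refl

𝟙-mono-∨ : {a b c : Bool} → (a ≡ true → b ≡ true ⊎ c ≡ true) → 𝟙 a ≤ 𝟙 b + 𝟙 c
𝟙-mono-∨ {false} f = z≤n
𝟙-mono-∨ {true}  f with f refl
... | inj₁ refl = s≤s z≤n
... | inj₂ refl = m≤n+m 1 _

search : (p : A → Bool) (xs : List A) → (∃ λ x → x ∈ xs × p x ≡ true) ⊎ (∀ {x} → x ∈ xs → p x ≡ false)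
search p xs with any? (λ x → p x ≟ᵇ true) xs
... | yes q = inj₁ (find q)
... | no ¬q = inj₂ λ x∈ → ¬-not (λ e → ¬q (lose x∈ e))

remove : {x : A} {xs : List A} → x ∈ xs → ∃ λ ys → xs ↭ x ∷ ys
remove x∈ with ∈-∃++ x∈
... | ys , zs , refl = _ , shift _ ys zs

Unique-resp-↭ : {xs ys : List A} → xs ↭ ys → Unique xs → Unique ys
Unique-resp-↭ {A} p = Permutationₛ.Unique-resp-↭ (setoid A) (↭⇒↭ₛ p)

count-mono-∨ : {p q r : A → Bool} (xs : List A) → (∀ {x} → x ∈ xs → p x ≡ true → q x ≡ true ⊎ r x ≡ true) →
               count p xs ≤ count q xs + count r xs
count-mono-∨ [] f = z≤n
count-mono-∨ {p = p} {q} {r} (x ∷ xs) f = begin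
  𝟙 (p x) + count p xs                           ≤⟨ +-mono-≤ (𝟙-mono-∨ (f (here refl))) (count-mono-∨ xs (f ∘ there)) ⟩
  𝟙 (q x) + 𝟙 (r x) + (count q xs + count r xs)  ≡⟨ +-interchange (𝟙 (q x)) (𝟙 (r x)) (count q xs) (count r xs) ⟩
  𝟙 (q x) + count q xs + (𝟙 (r x) + count r xs)  ∎
  where open ≤-Reasoning

count-false : {p : A → Bool} (xs : List A) → (∀ {x} → x ∈ xs → p x ≡ false) → count p xs ≡ 0
count-false [] f = refl
count-false {p = p} (x ∷ xs) f rewrite f (here refl) = count-false xs (f ∘ there)

count-mono : {p q : A → Bool} (xs : List A) → (∀ {x} → x ∈ xs → p x ≡ true → q x ≡ true) → count p xs ≤ count q xs
count-mono {p = p} {q} xs f = begin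
  count p xs                           ≤⟨ count-mono-∨ xs (λ x∈ e → inj₁ (f x∈ e)) ⟩
  count q xs + count (λ _ → false) xs  ≡⟨ cong (count q xs +_) (count-false xs (λ _ → refl)) ⟩
  count q xs + 0                       ≡⟨ +-identityʳ _ ⟩
  count q xs                           ∎
  where open ≤-Reasoning

count-cong : {p q : A → Bool} (xs : List A) → (∀ x → p x ≡ q x) → count p xs ≡ count q xs
count-cong [] f = refl
count-cong (x ∷ xs) f = cong₂ (λ a b → 𝟙 a + b) (f x) (count-cong xs f)

count-split : (p q : A → Bool) (xs : List A) →
              count p xs ≡ count (λ x → p x ∧ q x) xs + count (λ x → p x ∧ not (q x)) xs
count-split p q [] = refl
count-split p q (x ∷ xs) with p x | q x | count-split p q xs
... | true  | true  | ih = cong suc ih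
... | true  | false | ih = trans (cong suc ih) (≡-sym (+-suc _ _))
... | false | _     | ih = ih

count-↭ : (p : A → Bool) {xs ys : List A} → xs ↭ ys → count p xs ≡ count p ys
count-↭ p refl = refl
count-↭ p (prep x r) = cong (𝟙 (p x) +_) (count-↭ p r)
count-↭ p (swap {xs} {ys} x y r) = begin
  𝟙 (p x) + (𝟙 (p y) + count p xs)  ≡⟨ cong (λ c → 𝟙 (p x) + (𝟙 (p y) + c)) (count-↭ p r) ⟩
  𝟙 (p x) + (𝟙 (p y) + count p ys)  ≡⟨ left-comm (𝟙 (p x)) (𝟙 (p y)) (count p ys) ⟩
  𝟙 (p y) + (𝟙 (p x) + count p ys)  ∎
  where
  open ≡-Reasoning
  left-comm : ∀ a b c → a + (b + c) ≡ b + (a + c)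
  left-comm = solve-∀
count-↭ p (↭-trans r s) = trans (count-↭ p r) (count-↭ p s)

-- Pigeonhole: each counted element deletes one occurrence from `ys`. As `xs` has no repetition, the
-- later counted elements survive the deletion.
count-≤-length : {p : A → Bool} {xs : List A} (ys : List A) → Unique xs →
                 (∀ {x} → x ∈ xs → p x ≡ true → x ∈ ys) → count p xs ≤ length ys
count-≤-length {xs = []} ys u f = z≤n
count-≤-length {p = p} {x ∷ xs} ys (x≢ ∷ u) f with p x in px
... | false = count-≤-length ys u (f ∘ there)
... | true with remove (f (here refl) px)
...   | zs , ys↭ = subst (suc (count p xs) ≤_) (≡-sym (↭-length ys↭)) (s≤s (count-≤-length zs u rest))
  where
  rest : ∀ {y} → y ∈ xs → p y ≡ true → y ∈ zs
  rest y∈ py with ∈-resp-↭ ys↭ (f (there y∈) py)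
  ... | here refl = ⊥-elim (All.lookup x≢ y∈ refl)
  ... | there q   = q

-- Pairs of a list without repetition are counted once, in the order of the list.
edgeCount : (A → A → Bool) → List A → ℕ
edgeCount R []       = 0
edgeCount R (x ∷ xs) = count (R x) xs + edgeCount R xs

arcs : (A → A → Bool) → List A → ℕ
arcs R xs = sum (map (λ x → count (R x) xs) xs)

arcs-∷ : (R : A → A → Bool) (x : A) (xs : List A) →
         arcs R (x ∷ xs) ≡ 𝟙 (R x x) + count (R x) xs + (count (flip R x) xs + arcs R xs)
arcs-∷ R x xs = cong (𝟙 (R x x) + count (R x) xs +_) (go xs)
  where
  go : ∀ ys → sum (map (λ y → count (R y) (x ∷ xs)) ys) ≡ count (flip R x) ys + sum (map (λ y → count (R y) xs) ys)
  go []       = refl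
  go (y ∷ ys) = trans (cong (𝟙 (R y x) + count (R y) xs +_) (go ys))
    (+-interchange (𝟙 (R y x)) (count (R y) xs) (count (flip R x) ys) (sum (map (λ y → count (R y) xs) ys)))

handshake : {R : A → A → Bool} → (∀ x y → R x y ≡ R y x) → (∀ x → R x x ≡ false) →
            (xs : List A) → arcs R xs ≡ 2 * edgeCount R xs
handshake R-sym R-irr [] = refl
handshake {R = R} R-sym R-irr (x ∷ xs) = begin
  arcs R (x ∷ xs)                                                 ≡⟨ arcs-∷ R x xs ⟩
  𝟙 (R x x) + count (R x) xs + (count (flip R x) xs + arcs R xs)  ≡⟨ cong₂ (λ b c → 𝟙 b + count (R x) xs + (c + arcs R xs)) (R-irr x) (count-cong xs (λ y → R-sym y x)) ⟩
  count (R x) xs + (count (R x) xs + arcs R xs)                   ≡⟨ cong (λ c → count (R x) xs + (count (R x) xs + c)) (handshake R-sym R-irr xs) ⟩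
  count (R x) xs + (count (R x) xs + 2 * edgeCount R xs)          ≡⟨ double (count (R x) xs) (edgeCount R xs) ⟩
  2 * (count (R x) xs + edgeCount R xs)                           ∎
  where
  open ≡-Reasoning
  double : ∀ a b → a + (a + 2 * b) ≡ 2 * (a + b)
  double = solve-∀

-- Each `R`-pair is charged to an `S`-arc between its ends, so a bound on the outdegrees of `S`
-- bounds the number of `R`-pairs.
edgeCount-≤-arcs : {R S : A → A → Bool} → (∀ {x y} → R x y ≡ true → S x y ≡ true ⊎ S y x ≡ true) →
                   (xs : List A) → edgeCount R xs ≤ arcs S xs
edgeCount-≤-arcs f [] = z≤n
edgeCount-≤-arcs {R = R} {S} f (x ∷ xs) = begin
  count (R x) xs + edgeCount R xs                                 ≤⟨ +-mono-≤ (count-mono-∨ xs (λ _ → f)) (edgeCount-≤-arcs f xs) ⟩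
  count (S x) xs + count (flip S x) xs + arcs S xs                ≤⟨ m≤n+m _ (𝟙 (S x x)) ⟩
  𝟙 (S x x) + (count (S x) xs + count (flip S x) xs + arcs S xs)  ≡⟨ reassoc (𝟙 (S x x)) (count (S x) xs) (count (flip S x) xs) (arcs S xs) ⟩
  𝟙 (S x x) + count (S x) xs + (count (flip S x) xs + arcs S xs)  ≡⟨ ≡-sym (arcs-∷ S x xs) ⟩
  arcs S (x ∷ xs)                                                 ∎
  where
  open ≤-Reasoning
  reassoc : ∀ a b c d → a + (b + c + d) ≡ a + b + (c + d)
  reassoc = solve-∀

edgeCount-mono-∨ : {R S T : A → A → Bool} (xs : List A) →
                   (∀ {x y} → x ∈ xs → y ∈ xs → R x y ≡ true → S x y ≡ true ⊎ T x y ≡ true) →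
                   edgeCount R xs ≤ edgeCount S xs + edgeCount T xs
edgeCount-mono-∨ [] f = z≤n
edgeCount-mono-∨ {R = R} {S} {T} (x ∷ xs) f = begin
  count (R x) xs + edgeCount R xs
    ≤⟨ +-mono-≤ (count-mono-∨ xs (λ y∈ → f (here refl) (there y∈))) (edgeCount-mono-∨ xs (λ x∈ y∈ → f (there x∈) (there y∈))) ⟩
  count (S x) xs + count (T x) xs + (edgeCount S xs + edgeCount T xs)
    ≡⟨ +-interchange (count (S x) xs) (count (T x) xs) (edgeCount S xs) (edgeCount T xs) ⟩
  count (S x) xs + edgeCount S xs + (count (T x) xs + edgeCount T xs) ∎
  where open ≤-Reasoning

edgeCount-false : (xs : List A) → edgeCount (λ _ _ → false) xs ≡ 0
edgeCount-false []       = refl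
edgeCount-false (x ∷ xs) = cong₂ _+_ (count-false xs (λ _ → refl)) (edgeCount-false xs)

edgeCount-mono : {R S : A → A → Bool} (xs : List A) →
                 (∀ {x y} → x ∈ xs → y ∈ xs → R x y ≡ true → S x y ≡ true) → edgeCount R xs ≤ edgeCount S xs
edgeCount-mono {R = R} {S} xs f = begin
  edgeCount R xs                                 ≤⟨ edgeCount-mono-∨ xs (λ x∈ y∈ e → inj₁ (f x∈ y∈ e)) ⟩
  edgeCount S xs + edgeCount (λ _ _ → false) xs  ≡⟨ cong (edgeCount S xs +_) (edgeCount-false xs) ⟩
  edgeCount S xs + 0                             ≡⟨ +-identityʳ _ ⟩
  edgeCount S xs                                 ∎
  where open ≤-Reasoning

edgeCount-↭ : {R : A → A → Bool} → (∀ x y → R x y ≡ R y x) → {xs ys : List A} → xs ↭ ys → edgeCount R xs ≡ edgeCount R ys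
edgeCount-↭ R-sym refl = refl
edgeCount-↭ {R = R} R-sym (prep x r) = cong₂ _+_ (count-↭ (R x) r) (edgeCount-↭ R-sym r)
edgeCount-↭ {R = R} R-sym (swap {xs} {ys} x y r)
  rewrite R-sym y x | count-↭ (R x) r | count-↭ (R y) r | edgeCount-↭ R-sym r =
  +-interchange (𝟙 (R x y)) (count (R x) ys) (count (R y) ys) (edgeCount R ys)
edgeCount-↭ R-sym (↭-trans r s) = trans (edgeCount-↭ R-sym r) (edgeCount-↭ R-sym s)

sum-map-≤ : (f : A → ℕ) (d : ℕ) (xs : List A) → (∀ {x} → x ∈ xs → f x ≤ d) → sum (map f xs) ≤ length xs * d
sum-map-≤ f d [] h = z≤n
sum-map-≤ f d (x ∷ xs) h = +-mono-≤ (h (here refl)) (sum-map-≤ f d xs (h ∘ there))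

sum-map-≥ : (f : A → ℕ) (d : ℕ) (xs : List A) → (∀ {x} → x ∈ xs → d ≤ f x) → length xs * d ≤ sum (map f xs)
sum-map-≥ f d [] h = z≤n
sum-map-≥ f d (x ∷ xs) h = +-mono-≤ (h (here refl)) (sum-map-≥ f d xs (h ∘ there))

-- Clique minors in dense graphs

open MinorModel

_∈?_ : (x : Fin N) (xs : List (Fin N)) → Dec (x ∈ xs)
_∈?_ = member? _≟ᶠ_

≟-refl : (x : Fin N) → ⌊ x ≟ᶠ x ⌋ ≡ true
≟-refl x with x ≟ᶠ x
... | yes _   = refl
... | no x≢x = ⊥-elim (x≢x refl)

⌊⌋-true⁻ : {P : Set} (d : Dec P) → ⌊ d ⌋ ≡ true → P
⌊⌋-true⁻ (yes p) _ = p

⌊⌋-true⁺ : {P : Set} (d : Dec P) → P → ⌊ d ⌋ ≡ true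
⌊⌋-true⁺ (yes _) _ = refl
⌊⌋-true⁺ (no ¬p) p = ⊥-elim (¬p p)

⌊⌋-false⁺ : {P : Set} (d : Dec P) → ¬ P → ⌊ d ⌋ ≡ false
⌊⌋-false⁺ (yes p) ¬p = ⊥-elim (¬p p)
⌊⌋-false⁺ (no _)  _  = refl

-- Symmetrising and deleting loops turns any Boolean relation into a graph. Contracted graphs and
-- closures can thus be given as bare relations on the old vertex type.
simple : (Fin N → Fin N → Bool) → Fin N → Fin N → Bool
simple R x y = not ⌊ x ≟ᶠ y ⌋ ∧ (R x y ∨ R y x)

simple-irr : (R : Fin N → Fin N → Bool) (x : Fin N) → simple R x x ≡ false
simple-irr R x rewrite ≟-refl x = refl

simple-⁻ : (R : Fin N → Fin N → Bool) {x y : Fin N} → simple R x y ≡ true →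
           x ≢ y × (R x y ≡ true ⊎ R y x ≡ true)
simple-⁻ R {x} {y} e with x ≟ᶠ y
... | no x≢y = x≢y , ∨-true⁻ e

simple-⁺ : (R : Fin N → Fin N → Bool) {x y : Fin N} → x ≢ y → R x y ≡ true ⊎ R y x ≡ true →
           simple R x y ≡ true
simple-⁺ R {x} {y} x≢y r with x ≟ᶠ y
... | yes x≡y = ⊥-elim (x≢y x≡y)
... | no _ with r
...   | inj₁ p = ∨-true⁺ˡ p
...   | inj₂ p = ∨-true⁺ʳ {R x y} p

simple-sym : (R : Fin N → Fin N → Bool) (x y : Fin N) → simple R x y ≡ simple R y x
simple-sym R x y = bool-ext (go x y) (go y x)
  where
  go : ∀ x y → simple R x y ≡ true → simple R y x ≡ true
  go x y e = let (x≢y , r) = simple-⁻ R e in simple-⁺ R (x≢y ∘ ≡-sym) (⊎-swap r)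

simpleGraph : (N : ℕ) → (Fin N → Fin N → Bool) → Graph
simpleGraph N R = record { n = N ; adj = simple R ; sym = simple-sym R ; irrefl = simple-irr R }

adj⇒≢ : (G : Graph) {u v : Fin (n G)} → adj G u v ≡ true → u ≢ v
adj⇒≢ G {u} e refl = true≢false e (irrefl G u)

adj-sym : (G : Graph) {u v : Fin (n G)} → adj G u v ≡ true → adj G v u ≡ true
adj-sym G {u} {v} e = trans (sym G v u) e

complete : ℕ → Graph
complete t = simpleGraph t (λ _ _ → true)

-- Confining the branch sets to a list `X` stands for passing to the subgraph induced on `X`,
-- without renumbering its vertices.
record CliqueMinorIn (t : ℕ) (G : Graph) (X : List (Fin (n G))) : Set where
  field
    model     : MinorModel (complete t) G
    supported : ∀ {g h} → branch model g ≡ just h → g ∈ X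

open CliqueMinorIn

module _ {G : Graph} where

  walk-mono : {S S′ : Fin (n G) → Set} → (∀ {w} → S w → S′ w) → ∀ {u v} → WalkIn G S u v → WalkIn G S′ u v
  walk-mono f (here s)     = here (f s)
  walk-mono f (step s e w) = step (f s) e (walk-mono f w)

  walk-trans : {S : Fin (n G) → Set} → ∀ {u v w} → WalkIn G S u v → WalkIn G S v w → WalkIn G S u w
  walk-trans (here _)     w′ = w′
  walk-trans (step s e w) w′ = step s e (walk-trans w w′)

  walk-start : {S : Fin (n G) → Set} → ∀ {u v} → WalkIn G S u v → S u
  walk-start (here s)     = s
  walk-start (step s _ _) = s

>>=-just⁻ : {B C : Set} (f : B → Maybe C) (m : Maybe B) {c : C} → (m >>= f) ≡ just c →
              ∃ λ x → m ≡ just x × f x ≡ just c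
>>=-just⁻ f (just x) e = x , refl , e

-- Contracting the stars ρ⁻¹(x), x ∈ X, turns (part of) G into the graph R on X.
module StarContraction
  (G : Graph) (R : Fin (n G) → Fin (n G) → Bool) (X X₀ : List (Fin (n G)))
  (ρ : Fin (n G) → Maybe (Fin (n G)))
  (centre : ∀ {x} → x ∈ X → ρ x ≡ just x)
  (star : ∀ {g x} → ρ g ≡ just x → g ∈ X₀ × (g ≡ x ⊎ adj G g x ≡ true))
  (lift : ∀ {x y} → x ∈ X → y ∈ X → simple R x y ≡ true →
          ∃ λ g → ∃ λ g′ → ρ g ≡ just x × ρ g′ ≡ just y × adj G g g′ ≡ true)
  where

  -- The new branch set of `h` is the union of the stars of its old vertices. It is connected
  -- because every edge of a walk lifts to an edge between two stars, and inside a star one walks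
  -- through the centre.
  pull-back : ∀ {t} → CliqueMinorIn t (simpleGraph (n G) R) X → CliqueMinorIn t G X₀
  pull-back {t} k = record
    { model = record
      { branch    = br
      ; nonempty  = λ h → let (x , e) = nonempty m h in x , br-of (centre (supported k e)) e
      ; connected = conn
      ; edges     = edge
      }
    ; supported = λ {g} e → let (_ , ρg , _) = >>=-just⁻ (branch m) (ρ g) e in proj₁ (star ρg)
    }
    where
    m : MinorModel (complete t) (simpleGraph (n G) R)
    m = model k
    br : Fin (n G) → Maybe (Fin t)
    br g = ρ g >>= branch m
    br-of : ∀ {g x h} → ρ g ≡ just x → branch m x ≡ just h → br g ≡ just h
    br-of ρg e = trans (cong (_>>= branch m) ρg) e
    In : Fin t → Fin (n G) → Set
    In h w = br w ≡ just h
    to-centre : ∀ {g x h} → ρ g ≡ just x → branch m x ≡ just h → WalkIn G (In h) g x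
    to-centre ρg e with proj₂ (star ρg)
    ... | inj₁ refl = here (br-of ρg e)
    ... | inj₂ a    = step (br-of ρg e) a (here (br-of (centre (supported k e)) e))
    from-centre : ∀ {g x h} → ρ g ≡ just x → branch m x ≡ just h → WalkIn G (In h) x g
    from-centre ρg e with proj₂ (star ρg)
    ... | inj₁ refl = here (br-of ρg e)
    ... | inj₂ a    = step (br-of (centre (supported k e)) e) (adj-sym G a) (here (br-of ρg e))
    lift-walk : ∀ {x y h} → WalkIn (simpleGraph (n G) R) (λ w → branch m w ≡ just h) x y → WalkIn G (In h) x y
    lift-walk (here s) = here (br-of (centre (supported k s)) s)
    lift-walk (step s e w) with lift (supported k s) (supported k (walk-start w)) e
    ... | g , g′ , ρg , ρg′ , a =
      walk-trans (from-centre ρg s)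
        (step (br-of ρg s) a (walk-trans (to-centre ρg′ (walk-start w)) (lift-walk w)))
    conn : ∀ h u v → br u ≡ just h → br v ≡ just h → WalkIn G (In h) u v
    conn h u v eu ev with >>=-just⁻ (branch m) (ρ u) eu | >>=-just⁻ (branch m) (ρ v) ev
    ... | x , ρu , ex | y , ρv , ey =
      walk-trans (to-centre ρu ex) (walk-trans (lift-walk (connected m h x y ex ey)) (from-centre ρv ey))
    edge : ∀ h h′ → adj (complete t) h h′ ≡ true →
           ∃ λ g → ∃ λ g′ → br g ≡ just h × br g′ ≡ just h′ × adj G g g′ ≡ true
    edge h h′ a with edges m h h′ a
    ... | x , y , ex , ey , e with lift (supported k ex) (supported k ey) e
    ...   | g , g′ , ρg , ρg′ , ag = g , g′ , br-of ρg ex , br-of ρg′ ey , ag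

open StarContraction using (pull-back)

search² : (p : A → A → Bool) (xs : List A) →
          (∃ λ x → ∃ λ y → x ∈ xs × y ∈ xs × p x y ≡ true) ⊎ (∀ {x y} → x ∈ xs → y ∈ xs → p x y ≡ false)
search² p xs with any? (λ x → any? (λ y → p x y ≟ᵇ true) xs) xs
... | yes q = let (x , x∈ , q′) = find q ; (y , y∈ , e) = find q′ in inj₁ (x , y , x∈ , y∈ , e)
... | no ¬q = inj₂ λ x∈ y∈ → ¬-not (λ e → ¬q (lose x∈ (lose y∈ e)))

count-filter : (p q : A → Bool) (xs : List A) →
               count p (filter (λ x → q x ≟ᵇ true) xs) ≡ count (λ x → q x ∧ p x) xs
count-filter p q [] = refl
count-filter p q (x ∷ xs) with q x
... | true  = cong (𝟙 (p x) +_) (count-filter p q xs)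
... | false = count-filter p q xs

-- Inclusion and exclusion. With `p` and `q` the neighbourhoods of two merged vertices, the last
-- term counts the edges that coincide after merging.
count-∨-∧ : {p q r : A → Bool} (xs : List A) →
            (∀ {x} → x ∈ xs → p x ≡ true ⊎ q x ≡ true → r x ≡ true) →
            count p xs + count q xs ≤ count r xs + count (λ x → p x ∧ q x) xs
count-∨-∧ [] f = z≤n
count-∨-∧ {p = p} {q} {r} (x ∷ xs) f = begin
  𝟙 (p x) + count p xs + (𝟙 (q x) + count q xs)   ≡⟨ +-interchange (𝟙 (p x)) (count p xs) (𝟙 (q x)) (count q xs) ⟩
  𝟙 (p x) + 𝟙 (q x) + (count p xs + count q xs)   ≤⟨ +-mono-≤ (pointwise (p x) (q x) (r x) (f (here refl))) (count-∨-∧ xs (f ∘ there)) ⟩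
  𝟙 (r x) + 𝟙 (p x ∧ q x) + (count r xs + count (λ x → p x ∧ q x) xs)
    ≡⟨ +-interchange (𝟙 (r x)) (𝟙 (p x ∧ q x)) (count r xs) (count (λ x → p x ∧ q x) xs) ⟩
  𝟙 (r x) + count r xs + (𝟙 (p x ∧ q x) + count (λ x → p x ∧ q x) xs) ∎
  where
  open ≤-Reasoning
  pointwise : ∀ a b c → (a ≡ true ⊎ b ≡ true → c ≡ true) → 𝟙 a + 𝟙 b ≤ 𝟙 c + 𝟙 (a ∧ b)
  pointwise false false c g = z≤n
  pointwise false true  c g rewrite g (inj₂ refl) = ≤-refl
  pointwise true  b     c g rewrite g (inj₁ refl) = ≤-refl

-- The edge `uv` is contracted into `u`: `touch` hands the neighbours of `v` to `u`, and `v` leaves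
-- the list, so that the new graph lives on `u ∷ Y`.
module EdgeContraction (G : Graph) (u v : Fin (n G)) (uv : adj G u v ≡ true) (Y X : List (Fin (n G)))
                       (X↭ : X ↭ u ∷ v ∷ Y) (unique : Unique X) where

  touch contracted : Fin (n G) → Fin (n G) → Bool
  touch x y = ⌊ x ≟ᶠ u ⌋ ∧ adj G v y
  contracted x y = adj G x y ∨ touch x y

  private
    ρ : Fin (n G) → Maybe (Fin (n G))
    ρ g = if ⌊ g ≟ᶠ v ⌋ then just u else (if ⌊ g ∈? (u ∷ Y) ⌋ then just g else nothing)

    unique′ : Unique (u ∷ v ∷ Y)
    unique′ = Unique-resp-↭ X↭ unique

    v∉ : v ∉ u ∷ Y
    v∉ (here refl) = adj⇒≢ G uv refl
    v∉ (there v∈) with unique′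
    ... | _ ∷ v≢ ∷ _ = All.lookup v≢ v∈ refl

    u∉ : u ∉ Y
    u∉ u∈ with unique′
    ... | (_ ∷ u≢) ∷ _ = All.lookup u≢ u∈ refl

    ρ-v : ρ v ≡ just u
    ρ-v rewrite ≟-refl v = refl

    ρ-centre : ∀ {x} → x ∈ u ∷ Y → ρ x ≡ just x
    ρ-centre {x} x∈ with x ≟ᶠ v
    ... | yes refl = ⊥-elim (v∉ x∈)
    ... | no _ with x ∈? (u ∷ Y)
    ...   | yes _  = refl
    ...   | no x∉ = ⊥-elim (x∉ x∈)

    ρ-star : ∀ {g x} → ρ g ≡ just x → g ∈ X × (g ≡ x ⊎ adj G g x ≡ true)
    ρ-star {g} e with g ≟ᶠ v
    ρ-star refl | yes refl = ∈-resp-↭ (↭-sym X↭) (there (here refl)) , inj₂ (adj-sym G uv)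
    ρ-star {g} e | no _ with g ∈? (u ∷ Y)
    ρ-star refl | no _ | yes (here refl) = ∈-resp-↭ (↭-sym X↭) (here refl) , inj₁ refl
    ρ-star refl | no _ | yes (there g∈)  = ∈-resp-↭ (↭-sym X↭) (there (there g∈)) , inj₁ refl

    ρ-lift : ∀ {x y} → x ∈ u ∷ Y → y ∈ u ∷ Y → simple contracted x y ≡ true →
             ∃ λ g → ∃ λ g′ → ρ g ≡ just x × ρ g′ ≡ just y × adj G g g′ ≡ true
    ρ-lift {x} {y} x∈ y∈ e = [ half x∈ y∈ , (λ c → turn (half y∈ x∈ c)) ]′ (proj₂ (simple-⁻ contracted e))
      where
      half : ∀ {x y} → x ∈ u ∷ Y → y ∈ u ∷ Y → contracted x y ≡ true →
             ∃ λ g → ∃ λ g′ → ρ g ≡ just x × ρ g′ ≡ just y × adj G g g′ ≡ true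
      half {x} {y} x∈ y∈ c with ∨-true⁻ {adj G x y} c
      ... | inj₁ a = x , y , ρ-centre x∈ , ρ-centre y∈ , a
      ... | inj₂ b with ∧-true⁻ b
      ...   | x≡u , a with ⌊⌋-true⁻ (x ≟ᶠ u) x≡u
      ...     | refl = v , y , ρ-v , ρ-centre y∈ , a
      turn : (∃ λ g → ∃ λ g′ → ρ g ≡ just y × ρ g′ ≡ just x × adj G g g′ ≡ true) →
             ∃ λ g → ∃ λ g′ → ρ g ≡ just x × ρ g′ ≡ just y × adj G g g′ ≡ true
      turn (g , g′ , p , q , a) = g′ , g , q , p , adj-sym G a

  uncontract : ∀ {t} → CliqueMinorIn t (simpleGraph (n G) contracted) (u ∷ Y) → CliqueMinorIn t G X
  uncontract = pull-back G contracted (u ∷ Y) X ρ ρ-centre ρ-star ρ-lift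

  common : ℕ
  common = count (λ y → adj G u y ∧ adj G v y) X

  -- The edges lost are `uv` itself and one for each common neighbour, whose edges to `u` and to `v`
  -- become the same edge.
  edgeCount-contracted : edgeCount (adj G) X ≤ suc common + edgeCount (simple contracted) (u ∷ Y)
  edgeCount-contracted = begin
    edgeCount (adj G) X
      ≡⟨ edgeCount-↭ (sym G) X↭ ⟩
    𝟙 (adj G u v) + count (adj G u) Y + (count (adj G v) Y + edgeCount (adj G) Y)
      ≡⟨ cong (λ b → 𝟙 b + count (adj G u) Y + (count (adj G v) Y + edgeCount (adj G) Y)) uv ⟩
    suc (count (adj G u) Y + (count (adj G v) Y + edgeCount (adj G) Y))
      ≡⟨ cong suc (≡-sym (+-assoc (count (adj G u) Y) _ _)) ⟩
    suc (count (adj G u) Y + count (adj G v) Y + edgeCount (adj G) Y)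
      ≤⟨ s≤s (+-mono-≤ (count-∨-∧ Y merged) (edgeCount-mono Y (λ _ _ a → simple-⁺ contracted (adj⇒≢ G a) (inj₁ (∨-true⁺ˡ a))))) ⟩
    suc (count (simple contracted u) Y + common-Y + edgeCount (simple contracted) Y)
      ≡⟨ cong suc (rearrange (count (simple contracted u) Y) common-Y _) ⟩
    suc (common-Y + edgeCount (simple contracted) (u ∷ Y))
      ≤⟨ s≤s (+-monoˡ-≤ _ common-≤) ⟩
    suc common + edgeCount (simple contracted) (u ∷ Y) ∎
    where
    open ≤-Reasoning
    common-Y : ℕ
    common-Y = count (λ y → adj G u y ∧ adj G v y) Y
    common-≤ : common-Y ≤ common
    common-≤ = ≤-trans (≤-trans (m≤n+m common-Y (𝟙 (adj G u v ∧ adj G v v))) (m≤n+m _ (𝟙 (adj G u u ∧ adj G v u))))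
      (≤-reflexive (≡-sym (count-↭ (λ y → adj G u y ∧ adj G v y) X↭)))
    rearrange : ∀ a b c → a + b + c ≡ b + (a + c)
    rearrange = solve-∀
    merged : ∀ {y} → y ∈ Y → adj G u y ≡ true ⊎ adj G v y ≡ true → simple contracted u y ≡ true
    merged y∈ (inj₁ a) = simple-⁺ contracted (adj⇒≢ G a) (inj₁ (∨-true⁺ˡ a))
    merged {y} y∈ (inj₂ a) = simple-⁺ contracted (λ { refl → u∉ y∈ })
      (inj₁ (∨-true⁺ʳ {adj G u y} (∧-true⁺ (≟-refl u) a)))

-- The vertex `v` alone forms the new branch set. It is adjacent to all of `Y`, hence to a vertex of
-- every old branch set, and being no neighbour of itself it lies in none of them.
add-apex : (G : Graph) (v : Fin (n G)) {X Y : List (Fin (n G))} → v ∈ X →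
           (∀ {y} → y ∈ Y → y ∈ X × adj G v y ≡ true) →
           ∀ {t} → CliqueMinorIn t G Y → CliqueMinorIn (suc t) G X
add-apex G v {X} {Y} v∈ Y⊆ {t} k = record
  { model = record { branch = br ; nonempty = ne ; connected = conn ; edges = edge }
  ; supported = supp
  }
  where
  m : MinorModel (complete t) G
  m = model k
  br : Fin (n G) → Maybe (Fin (suc t))
  br g = if ⌊ g ≟ᶠ v ⌋ then just zero else mapᵐ suc (branch m g)
  br-v : br v ≡ just zero
  br-v rewrite ≟-refl v = refl
  br-suc : ∀ {g h} → branch m g ≡ just h → br g ≡ just (suc h)
  br-suc {g} e with g ≟ᶠ v
  ... | yes refl = ⊥-elim (adj⇒≢ G (proj₂ (Y⊆ (supported k e))) refl)
  ... | no _ rewrite e = refl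
  br-zero⁻ : ∀ {g} → br g ≡ just zero → g ≡ v
  br-zero⁻ {g} e with g ≟ᶠ v
  ... | yes p = p
  ... | no _ with branch m g
  br-zero⁻ () | no _ | just _
  br-zero⁻ () | no _ | nothing
  br-suc⁻ : ∀ {g h} → br g ≡ just (suc h) → branch m g ≡ just h
  br-suc⁻ {g} e with g ≟ᶠ v
  br-suc⁻ () | yes _
  ... | no _ with branch m g
  br-suc⁻ refl | no _ | just _ = refl
  br-suc⁻ ()   | no _ | nothing
  ne : ∀ h → ∃ λ g → br g ≡ just h
  ne zero    = v , br-v
  ne (suc h) = let (g , e) = nonempty m h in g , br-suc e
  conn : ∀ h u w → br u ≡ just h → br w ≡ just h → WalkIn G (λ x → br x ≡ just h) u w
  conn zero u w eu ew with br-zero⁻ eu | br-zero⁻ ew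
  ... | refl | refl = here eu
  conn (suc h) u w eu ew = walk-mono br-suc (connected m h u w (br-suc⁻ eu) (br-suc⁻ ew))
  Joined : Fin (suc t) → Fin (suc t) → Set
  Joined h h′ = ∃ λ g → ∃ λ g′ → br g ≡ just h × br g′ ≡ just h′ × adj G g g′ ≡ true
  edge : ∀ h h′ → adj (complete (suc t)) h h′ ≡ true → Joined h h′
  edge zero zero a = ⊥-elim (adj⇒≢ (complete (suc t)) {zero} {zero} a refl)
  edge zero (suc h) _ = let (g , e) = nonempty m h in
    v , g , br-v , br-suc e , proj₂ (Y⊆ (supported k e))
  edge (suc h) zero _ = let (g , e) = nonempty m h in
    g , v , br-suc e , br-v , adj-sym G (proj₂ (Y⊆ (supported k e)))
  edge (suc h) (suc h′) a =
    let h≢h′ : h ≢ h′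
        h≢h′ e = adj⇒≢ (complete (suc t)) {suc h} {suc h′} a (cong suc e)
        (g , g′ , e , e′ , ag) = edges m h h′ (simple-⁺ (λ _ _ → true) h≢h′ (inj₁ refl))
    in g , g′ , br-suc e , br-suc e′ , ag
  supp : ∀ {g h} → br g ≡ just h → g ∈ X
  supp {g} {zero} e with br-zero⁻ e
  ... | refl = v∈
  supp {g} {suc h} e = proj₁ (Y⊆ (supported k (br-suc⁻ e)))

-- Contract edges with fewer than 2^(t+1) common neighbours; once none is left, every neighbourhood is dense.
dense⇒cliqueMinor : ∀ t (G : Graph) (X : List (Fin (n G))) → Unique X → 1 ≤ length X →
                    length X * 2 ^ t ≤ edgeCount (adj G) X → CliqueMinorIn t G X
dense⇒cliqueMinor zero G X unique 1≤ dense = record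
  { model = record { branch = λ _ → nothing ; nonempty = λ () ; connected = λ () ; edges = λ () }
  ; supported = λ ()
  }
dense⇒cliqueMinor (suc t) G X unique 1≤ dense = go (length X) G X ≤-refl unique 1≤ dense
  where
  -- The factor two over the density `2 ^ t` required in a neighbourhood is what the handshake
  -- identity costs.
  K : ℕ
  K = 2 ^ suc t
  1≤2^ : ∀ k → 1 ≤ 2 ^ k
  1≤2^ k = m^n>0 2 k
  go : ∀ k (G : Graph) (X : List (Fin (n G))) → length X ≤ k → Unique X → 1 ≤ length X →
       length X * K ≤ edgeCount (adj G) X → CliqueMinorIn (suc t) G X
  go zero G (_ ∷ _) () _ _ _
  go (suc k) G X ≤k unique 1≤ dense
    with search² (λ u v → adj G u v ∧ ⌊ suc (count (λ y → adj G u y ∧ adj G v y) X) ≤? K ⌋) X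
  ... | inj₁ (u , v , u∈ , v∈ , e) = contract (remove u∈)
    where
    uv : adj G u v ≡ true
    uv = proj₁ (∧-true⁻ {adj G u v} e)
    few : suc (count (λ y → adj G u y ∧ adj G v y) X) ≤ K
    few = ⌊⌋-true⁻ (suc (count (λ y → adj G u y ∧ adj G v y) X) ≤? K) (proj₂ (∧-true⁻ {adj G u v} e))
    contract : (∃ λ Z → X ↭ u ∷ Z) → CliqueMinorIn (suc t) G X
    contract (Z , X↭Z) with ∈-resp-↭ X↭Z v∈
    ... | here refl = ⊥-elim (adj⇒≢ G uv refl)
    ... | there v∈Z with remove v∈Z
    ...   | Y , Z↭ = uncontract (go k (simpleGraph (n G) contracted) (u ∷ Y) size unique′ (s≤s z≤n) dense′)
      where
      X↭ : X ↭ u ∷ v ∷ Y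
      X↭ = ↭-trans X↭Z (prep u Z↭)
      open EdgeContraction G u v uv Y X X↭ unique
      unique′ : Unique (u ∷ Y)
      unique′ with Unique-resp-↭ X↭ unique
      ... | (_ ∷ u≢) ∷ _ ∷ r = u≢ ∷ r
      size : suc (length Y) ≤ k
      size = ≤-pred (subst (_≤ suc k) (↭-length X↭) ≤k)
      dense′ : suc (length Y) * K ≤ edgeCount (simple contracted) (u ∷ Y)
      -- One vertex and at most `K` edges disappear, so the density bound survives the contraction.
      dense′ = +-cancelˡ-≤ K _ _ (begin
        K + suc (length Y) * K                              ≡⟨ cong (_* K) (≡-sym (↭-length X↭)) ⟩
        length X * K                                        ≤⟨ dense ⟩
        edgeCount (adj G) X                                 ≤⟨ edgeCount-contracted ⟩
        suc common + edgeCount (simple contracted) (u ∷ Y)  ≤⟨ +-monoˡ-≤ _ few ⟩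
        K + edgeCount (simple contracted) (u ∷ Y)           ∎)
        where open ≤-Reasoning
  ... | inj₂ many with search² (adj G) X
  ...   | inj₂ none = contradiction
            -- Without an edge in the nonempty list `X`, the density hypothesis would give `1 ≤ 0`.
            (≤-trans (*-mono-≤ 1≤ (1≤2^ (suc t))) (≤-trans dense (edgeCount-mono X (λ x∈ y∈ a → ⊥-elim (true≢false a (none x∈ y∈))))))
            (λ 1≤0 → contradiction (subst (1 ≤_) (edgeCount-false X) 1≤0) λ ())
  ...   | inj₁ (v , w , v∈ , w∈ , vw) =
            add-apex G v v∈ (∈-filter⁻ Nv?)
              (dense⇒cliqueMinor t G Nv (Unique-filter⁺ Nv? unique) 1≤Nv dense′)
    where
    Nv? : ∀ y → Dec (adj G v y ≡ true)
    Nv? y = adj G v y ≟ᵇ true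
    Nv : List (Fin (n G))
    Nv = filter Nv? X
    1≤Nv : 1 ≤ length Nv
    1≤Nv with Nv | ∈-filter⁺ Nv? w∈ vw
    ... | _ ∷ _ | _ = s≤s z≤n
    -- No edge is contractible any more, so `v` and its neighbour `y` have at least `K` common
    -- neighbours; inside `Nv` this is a bound on the degree of `y`.
    common≥ : ∀ {y} → y ∈ Nv → K ≤ count (adj G y) Nv
    common≥ {y} y∈ with ∈-filter⁻ Nv? {xs = X} y∈
    ... | y∈X , vy = subst (K ≤_) (≡-sym (count-filter (adj G y) (adj G v) X))
      (≮⇒≥ λ lt → true≢false (∧-true⁺ vy (⌊⌋-true⁺ (suc (count (λ z → adj G v z ∧ adj G y z) X) ≤? K) lt)) (many v∈ y∈X))
    dense′ : length Nv * 2 ^ t ≤ edgeCount (adj G) Nv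
    dense′ = *-cancelˡ-≤ 2 (begin
      2 * (length Nv * 2 ^ t)   ≡⟨ reorder 2 (length Nv) (2 ^ t) ⟩
      length Nv * K             ≤⟨ sum-map-≥ (λ x → count (adj G x) Nv) K Nv common≥ ⟩
      arcs (adj G) Nv           ≡⟨ handshake (sym G) (irrefl G) Nv ⟩
      2 * edgeCount (adj G) Nv  ∎)
      where
      open ≤-Reasoning
      reorder : ∀ a b c → a * (b * c) ≡ b * (a * c)
      reorder = solve-∀

-- Degenerate orderings

Sparse : (Fin N → Fin N → Bool) → ℕ → Set
Sparse R D = ∀ X → Unique X → edgeCount R X ≤ length X * D

-- Degeneracy in the form in which it is used. The vertex deleted first stands first, so `back x`
-- covers the neighbours of `x` that come after `x` in `order`.
record Ordering (R : Fin N → Fin N → Bool) (d : ℕ) (X : List (Fin N)) : Set where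
  field
    order     : List (Fin N)
    order-↭   : order ↭ X
    back      : Fin N → List (Fin N)
    back-≤    : ∀ x → length (back x) ≤ d
    back-edge : AllPairs (λ x y → R x y ≡ true → y ∈ back x) order

open Ordering

AllPairs-map-∈ : {R S : A → A → Set} {xs : List A} → (∀ {x y} → x ∈ xs → y ∈ xs → R x y → S x y) →
                 AllPairs R xs → AllPairs S xs
AllPairs-map-∈ f [] = []
AllPairs-map-∈ f (r ∷ rs) =
  All.tabulate (λ y∈ → f (here refl) (there y∈) (All.lookup r y∈))
  ∷ AllPairs-map-∈ (λ x∈ y∈ → f (there x∈) (there y∈)) rs

length-filter-count : (q : A → Bool) (xs : List A) → length (filter (λ x → q x ≟ᵇ true) xs) ≡ count q xs
length-filter-count q [] = refl
length-filter-count q (x ∷ xs) with q x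
... | true  = cong suc (length-filter-count q xs)
... | false = length-filter-count q xs

update : Fin N → A → (Fin N → A) → Fin N → A
update x a f y = if ⌊ y ≟ᶠ x ⌋ then a else f y

update-same : (x : Fin N) (a : A) (f : Fin N → A) → update x a f x ≡ a
update-same x a f rewrite ≟-refl x = refl

update-other : {x y : Fin N} (a : A) (f : Fin N → A) → y ≢ x → update x a f y ≡ f y
update-other {x = x} {y} a f y≢x with y ≟ᶠ x
... | yes e = ⊥-elim (y≢x e)
... | no _  = refl

-- If all degrees in `X` exceeded `2 * D`, the handshake identity would yield more than
-- `length X * D` edges.
low-degree : {R : Fin N → Fin N → Bool} → (∀ x y → R x y ≡ R y x) → (∀ x → R x x ≡ false) →
             ∀ {D} → Sparse R D → (X : List (Fin N)) → Unique X → 1 ≤ length X →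
             ∃ λ x → x ∈ X × count (R x) X ≤ 2 * D
low-degree {R = R} R-sym R-irr {D} sparse X unique 1≤ with search (λ x → ⌊ count (R x) X ≤? 2 * D ⌋) X
... | inj₁ (x , x∈ , e) = x , x∈ , ⌊⌋-true⁻ (count (R x) X ≤? 2 * D) e
... | inj₂ high = contradiction (begin
    1 + 2 * (length X * D)         ≤⟨ +-monoˡ-≤ _ 1≤ ⟩
    length X + 2 * (length X * D)  ≡⟨ regroup (length X) D ⟩
    length X * suc (2 * D)         ≤⟨ sum-map-≥ (λ x → count (R x) X) (suc (2 * D)) X degree> ⟩
    arcs R X                       ≡⟨ handshake R-sym R-irr X ⟩
    2 * edgeCount R X              ≤⟨ *-monoʳ-≤ 2 (sparse X unique) ⟩
    2 * (length X * D)             ∎) (n≮n _)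
  where
  open ≤-Reasoning
  regroup : ∀ a b → a + 2 * (a * b) ≡ a * suc (2 * b)
  regroup = solve-∀
  degree> : ∀ {x} → x ∈ X → suc (2 * D) ≤ count (R x) X
  degree> {x} x∈ = ≰⇒> λ le → true≢false (⌊⌋-true⁺ (count (R x) X ≤? 2 * D) le) (high x∈)

-- A vertex of low degree is put first and the others are ordered recursively; sparsity speaks of
-- all lists without repetition, so it holds for the remaining vertices too.
sparse⇒ordering : {R : Fin N → Fin N → Bool} → (∀ x y → R x y ≡ R y x) → (∀ x → R x x ≡ false) →
                  ∀ {D} → Sparse R D → (X : List (Fin N)) → Unique X → Ordering R (2 * D) X
sparse⇒ordering {N} {R} R-sym R-irr {D} sparse X unique = go (length X) X ≤-refl unique
  where
  go : ∀ k X → length X ≤ k → Unique X → Ordering R (2 * D) X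
  go k [] _ _ = record { order = [] ; order-↭ = refl ; back = λ _ → [] ; back-≤ = λ _ → z≤n ; back-edge = [] }
  go (suc k) X@(_ ∷ _) ≤k unique with low-degree R-sym R-irr sparse X unique (s≤s z≤n)
  ... | x , x∈ , deg with remove x∈
  ...   | Y , X↭ = record
    { order     = x ∷ order rec
    ; order-↭   = ↭-trans (prep x (order-↭ rec)) (↭-sym X↭)
    ; back      = update x later (back rec)
    ; back-≤    = bounded
    ; back-edge = All.tabulate (λ {y} y∈ r → subst (y ∈_) (≡-sym (update-same x later (back rec))) (∈-filter⁺ R? y∈ r))
                  ∷ AllPairs-map-∈ (λ {v} {w} v∈ _ f r → subst (w ∈_) (≡-sym (update-other later (back rec) (x≢ v∈))) (f r)) (back-edge rec)
    }
    where
    unique′ : Unique (x ∷ Y)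
    unique′ = Unique-resp-↭ X↭ unique
    uniqueY : Unique Y
    uniqueY = AllPairs-tail unique′
    rec : Ordering R (2 * D) Y
    rec = go k Y (≤-pred (subst (_≤ suc k) (↭-length X↭) ≤k)) uniqueY
    x≢ : ∀ {v} → v ∈ order rec → v ≢ x
    x≢ v∈ v≡x = All.lookup (AllPairs-head unique′) (∈-resp-↭ (order-↭ rec) v∈) (≡-sym v≡x)
    R? : ∀ y → Dec (R x y ≡ true)
    R? y = R x y ≟ᵇ true
    later : List (Fin N)
    later = filter R? (order rec)
    later-≤ : length later ≤ 2 * D
    later-≤ = begin
      length later             ≡⟨ length-filter-count (R x) (order rec) ⟩
      count (R x) (order rec)  ≡⟨ count-↭ (R x) (order-↭ rec) ⟩
      count (R x) Y            ≤⟨ m≤n+m _ (𝟙 (R x x)) ⟩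
      count (R x) (x ∷ Y)      ≡⟨ ≡-sym (count-↭ (R x) X↭) ⟩
      count (R x) X            ≤⟨ deg ⟩
      2 * D                    ∎
      where open ≤-Reasoning
    bounded : ∀ v → length (update x later (back rec) v) ≤ 2 * D
    bounded v with v ≟ᶠ x
    ... | yes _ = later-≤
    ... | no _  = back-≤ rec v

-- Greedy colourings and bounded indices

fresh : ∀ {d} (l : List (Fin (suc d))) → length l ≤ d → ∃ λ c → ¬ c ∈ l
fresh {d} l l≤ with search (λ c → not ⌊ c ∈? l ⌋) (allFin (suc d))
... | inj₁ (c , _ , e) = c , λ c∈ → true≢false (⌊⌋-true⁺ (c ∈? l) c∈) (not-true⁻ e)
... | inj₂ all∈ = contradiction (begin
    suc d                                ≡⟨ ≡-sym (length-tabulate (λ x → x)) ⟩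
    length (allFin (suc d))              ≡⟨ ≡-sym (count-true (allFin (suc d))) ⟩
    count (λ _ → true) (allFin (suc d))  ≤⟨ count-≤-length {p = λ _ → true} l (Unique-allFin (suc d)) (λ {x} x∈ _ → in-l x (all∈ x∈)) ⟩
    length l                             ≤⟨ l≤ ⟩
    d                                    ∎) (n≮n d)
  where
  open ≤-Reasoning
  count-true : {A : Set} (xs : List A) → count (λ _ → true) xs ≡ length xs
  count-true []       = refl
  count-true (_ ∷ xs) = cong suc (count-true xs)
  in-l : ∀ x → not ⌊ x ∈? l ⌋ ≡ false → x ∈ l
  in-l x e with x ∈? l
  ... | yes x∈ = x∈

-- Colours are assigned from the end of the ordering. When `x` has its turn, its coloured neighbours
-- lie in `back x` and block at most `d` of the `suc d` colours.
greedy-colouring : {R : Fin N → Fin N → Bool} → (∀ x y → R x y ≡ R y x) → (∀ x → R x x ≡ false) →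
                   ∀ {d} → Ordering R d (allFin N) →
                   ∃ λ (κ : Fin N → Fin (suc d)) → ∀ {x y} → R x y ≡ true → κ x ≢ κ y
greedy-colouring {N} {R} R-sym R-irr {d} o = let (κ , proper) = go (order o) unique (back-edge o) in
  κ , λ {x} {y} r → All-pairs proper (listed x) (listed y) r
  where
  unique : Unique (order o)
  unique = Unique-resp-↭ (↭-sym (order-↭ o)) (Unique-allFin N)
  listed : ∀ x → x ∈ order o
  listed x = ∈-resp-↭ (↭-sym (order-↭ o)) (∈-allFin x)
  Separates : (Fin N → Fin (suc d)) → Fin N → Fin N → Set
  Separates κ x y = R x y ≡ true → κ x ≢ κ y
  All-pairs : ∀ {κ xs x y} → AllPairs (Separates κ) xs → x ∈ xs → y ∈ xs → Separates κ x y
  All-pairs (_ ∷ _) (here refl) (here refl) r = ⊥-elim (true≢false r (R-irr _))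
  All-pairs (s ∷ _) (here refl) (there y∈) r = All.lookup s y∈ r
  All-pairs (s ∷ _) (there x∈) (here refl) r e = All.lookup s x∈ (trans (R-sym _ _) r) (≡-sym e)
  All-pairs (_ ∷ ss) (there x∈) (there y∈) r = All-pairs ss x∈ y∈ r
  go : ∀ xs → Unique xs → AllPairs (λ x y → R x y ≡ true → y ∈ back o x) xs → ∃ λ κ → AllPairs (Separates κ) xs
  go [] _ _ = (λ _ → zero) , []
  go (x ∷ xs) (x≢ ∷ u) (b ∷ bs) with go xs u bs
  ... | κ , proper with fresh (map κ (back o x)) (subst (_≤ d) (≡-sym (length-map κ (back o x))) (back-≤ o x))
  ...   | c , c∉ = κ′ , All.tabulate new ∷ AllPairs-map-∈ old proper
    where
    κ′ : Fin N → Fin (suc d)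
    κ′ = update x c κ
    other : ∀ {y} → y ∈ xs → κ′ y ≡ κ y
    other y∈ = update-other c κ (λ e → All.lookup x≢ y∈ (≡-sym e))
    new : ∀ {y} → y ∈ xs → Separates κ′ x y
    new {y} y∈ r e = c∉ (subst (_∈ map κ (back o x))
      (trans (≡-sym (other y∈)) (trans (≡-sym e) (update-same x c κ))) (∈-map⁺ κ (All.lookup b y∈ r)))
    old : ∀ {y z} → y ∈ xs → z ∈ xs → Separates κ y z → Separates κ′ y z
    old y∈ z∈ s r e = s r (trans (≡-sym (other y∈)) (trans e (other z∈)))

-- Allows a vertex known to lie in a short list to be recorded by one of boundedly many numbers,
-- whatever `N` is.
local-index : (l : List (Fin N)) (d : ℕ) → length l ≤ d →
              ∃ λ (f : Fin N → Fin (suc d)) → ∀ {y z} → y ∈ l → z ∈ l → f y ≡ f z → y ≡ z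
local-index [] d _ = (λ _ → zero) , λ ()
local-index (x ∷ l) (suc d) (s≤s l≤) with local-index l d l≤
... | f , inj = g , g-inj
  where
  g : _ → Fin (suc (suc d))
  g = update x zero (suc ∘ f)
  suc-inj : ∀ {a b : Fin (suc d)} → Fin.suc a ≡ suc b → a ≡ b
  suc-inj refl = refl
  tail : ∀ {y} → y ≢ x → y ∈ x ∷ l → y ∈ l
  tail y≢ (here e)   = ⊥-elim (y≢ e)
  tail y≢ (there y∈) = y∈
  g-inj : ∀ {y z} → y ∈ x ∷ l → z ∈ x ∷ l → g y ≡ g z → y ≡ z
  g-inj {y} {z} y∈ z∈ e with y ≟ᶠ x | z ≟ᶠ x
  ... | yes p | yes q = trans p (≡-sym q)
  g-inj y∈ z∈ () | yes _ | no _
  g-inj y∈ z∈ () | no _  | yes _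
  ... | no p  | no q  = inj (tail p y∈) (tail q z∈) (suc-inj e)

-- Sparsity of the closure of an orientation

-- By symmetry the distinguished pair can be moved to the front of the list, where it counts for `S`
-- but not for `R`.
edgeCount-strict : {R S : A → A → Bool} → (∀ x y → R x y ≡ R y x) → (∀ x y → S x y ≡ S y x) →
                   (∀ {x y} → R x y ≡ true → S x y ≡ true) → {xs : List A} {x y : A} → x ∈ xs → y ∈ xs → x ≢ y →
                   R x y ≡ false → S x y ≡ true → suc (edgeCount R xs) ≤ edgeCount S xs
edgeCount-strict {R = R} {S} R-sym S-sym R⊆S {xs} {x} {y} x∈ y∈ x≢y ¬Rxy Sxy with remove x∈
... | zs , xs↭ with ∈-resp-↭ xs↭ y∈
...   | here y≡x  = ⊥-elim (x≢y (≡-sym y≡x))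
...   | there y∈′ with remove y∈′
...     | ws , zs↭ = begin
  suc (edgeCount R xs)                                     ≡⟨ cong suc (edgeCount-↭ R-sym xs↭′) ⟩
  suc (𝟙 (R x y) + count (R x) ws + edgeCount R (y ∷ ws))  ≡⟨ cong (λ b → suc (𝟙 b + count (R x) ws + edgeCount R (y ∷ ws))) ¬Rxy ⟩
  suc (count (R x) ws + edgeCount R (y ∷ ws))              ≤⟨ s≤s (+-mono-≤ (count-mono ws (λ _ → R⊆S)) (edgeCount-mono (y ∷ ws) (λ _ _ → R⊆S))) ⟩
  suc (count (S x) ws + edgeCount S (y ∷ ws))              ≡⟨ cong (λ b → 𝟙 b + count (S x) ws + edgeCount S (y ∷ ws)) (≡-sym Sxy) ⟩
  edgeCount S (x ∷ y ∷ ws)                                 ≡⟨ ≡-sym (edgeCount-↭ S-sym xs↭′) ⟩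
  edgeCount S xs                                           ∎
  where
  open ≤-Reasoning
  xs↭′ : xs ↭ x ∷ y ∷ ws
  xs↭′ = ↭-trans xs↭ (prep x zs↭)

edgeCount-product : (p : A → Bool) (xs : List A) → edgeCount (λ x y → p x ∧ p y) xs ≤ count p xs * count p xs
edgeCount-product p [] = z≤n
edgeCount-product p (x ∷ xs) with p x
... | false = subst (λ c → c + edgeCount (λ x y → p x ∧ p y) xs ≤ count p xs * count p xs)
                (≡-sym (count-false xs (λ _ → refl))) (edgeCount-product p xs)
... | true = begin
  k + edgeCount (λ x y → p x ∧ p y) xs  ≤⟨ +-monoʳ-≤ k (edgeCount-product p xs) ⟩
  k + k * k                             ≤⟨ m≤n+m _ (suc k) ⟩
  suc k + (k + k * k)                   ≡⟨ square k ⟩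
  suc k * suc k                         ∎
  where
  open ≤-Reasoning
  k : ℕ
  k = count p xs
  square : ∀ k → suc k + (k + k * k) ≡ suc k * suc k
  square = solve-∀

length-concatMap-≤ : {B : Set} (f : A → List B) (d : ℕ) → (∀ x → length (f x) ≤ d) →
                     (xs : List A) → length (concatMap f xs) ≤ length xs * d
length-concatMap-≤ f d f≤ [] = z≤n
length-concatMap-≤ f d f≤ (x ∷ xs) =
  ≤-trans (≤-reflexive (length-++ (f x))) (+-mono-≤ (f≤ x) (length-concatMap-≤ f d f≤ xs))

some : (Fin N → Bool) → Bool
some {N} p = ⌊ any? (λ x → p x ≟ᵇ true) (allFin N) ⌋

some-⁻ : {p : Fin N → Bool} → some p ≡ true → ∃ λ x → p x ≡ true
some-⁻ {N} {p} e = let (x , _ , px) = find (⌊⌋-true⁻ (any? (λ x → p x ≟ᵇ true) (allFin N)) e) in x , px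

some-⁺ : {p : Fin N → Bool} {x : Fin N} → p x ≡ true → some p ≡ true
some-⁺ {N} {p} {x} e = ⌊⌋-true⁺ (any? (λ x → p x ≟ᵇ true) (allFin N)) (lose (∈-allFin x) e)

cliqueMinor-free⇒sparse : ∀ {t} {G : Graph} {X : List (Fin (n G))} → Unique X →
                          ¬ CliqueMinorIn t G X → edgeCount (adj G) X ≤ length X * 2 ^ t
cliqueMinor-free⇒sparse {X = []} _ _ = z≤n
cliqueMinor-free⇒sparse {t} {G} {X@(_ ∷ _)} unique free =
  ≰⇒≥ λ dense → free (dense⇒cliqueMinor t G X unique (s≤s z≤n) dense)

widen : ∀ {t} {G : Graph} {X : List (Fin (n G))} → CliqueMinorIn t G X → CliqueMinorIn t G (allFin (n G))
widen k = record { model = model k ; supported = λ {g} _ → ∈-allFin g }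

-- The three summands are for adjacent pairs, pairs with a common in-neighbour and pairs joined by a
-- directed path of length two.
closeDensity : ℕ → ℕ → ℕ
closeDensity t d = 2 ^ t + ((2 ^ t + (2 ^ t + 1) * (d * d)) + d * d)

module Orientation (t : ℕ) (G : Graph) (free : ¬ CliqueMinorIn t G (allFin (n G)))
                   (d : ℕ) (outs : Fin (n G) → List (Fin (n G))) (outs-≤ : ∀ x → length (outs x) ≤ d) where

  V : Set
  V = Fin (n G)

  -- The lists `outs` may contain vertices that are not neighbours, so adjacency is required
  -- separately.
  out : V → V → Bool
  out x y = adj G x y ∧ ⌊ y ∈? outs x ⌋

  out⇒adj : ∀ {x y} → out x y ≡ true → adj G x y ≡ true
  out⇒adj {x} {y} e = proj₁ (∧-true⁻ {adj G x y} e)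

  out⇒∈outs : ∀ {x y} → out x y ≡ true → y ∈ outs x
  out⇒∈outs {x} {y} e = ⌊⌋-true⁻ (y ∈? outs x) (proj₂ (∧-true⁻ {adj G x y} e))

  outdegree : ∀ x {X} → Unique X → count (out x) X ≤ d
  outdegree x unique = ≤-trans (count-≤-length (outs x) unique (λ _ → out⇒∈outs)) (outs-≤ x)

  -- The list of admissible common in-neighbours is a parameter, so that they can be treated one at
  -- a time.
  shared : List V → V → V → Bool
  shared []       x y = false
  shared (b ∷ bs) x y = (out b x ∧ out b y) ∨ shared bs x y

  shared-⁺ : ∀ {b bs x y} → b ∈ bs → out b x ≡ true → out b y ≡ true → shared bs x y ≡ true
  shared-⁺ (here refl) ex ey = ∨-true⁺ˡ (∧-true⁺ ex ey)
  shared-⁺ {b} {c ∷ bs} {x} {y} (there b∈) ex ey = ∨-true⁺ʳ {out c x ∧ out c y} (shared-⁺ b∈ ex ey)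

  two-step : V → V → Bool
  two-step x z = some λ y → out x y ∧ out y z

  -- At most `d * d` directed paths of length two start at a vertex; counting pairs by their
  -- starting vertices bounds their number.
  two-step-sparse : Sparse (simple two-step) (d * d)
  two-step-sparse X unique = begin
    edgeCount (simple two-step) X  ≤⟨ edgeCount-≤-arcs (λ {x} {y} e → proj₂ (simple-⁻ two-step {x} {y} e)) X ⟩
    arcs two-step X                ≤⟨ sum-map-≤ (λ x → count (two-step x) X) (d * d) X (λ {x} _ → degree x) ⟩
    length X * (d * d)             ∎
    where
    open ≤-Reasoning
    degree : ∀ x → count (two-step x) X ≤ d * d
    degree x = begin
      count (two-step x) X              ≤⟨ count-≤-length (concatMap outs (outs x)) unique (λ _ → reach) ⟩
      length (concatMap outs (outs x))  ≤⟨ length-concatMap-≤ outs d outs-≤ (outs x) ⟩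
      length (outs x) * d               ≤⟨ *-monoˡ-≤ d (outs-≤ x) ⟩
      d * d                             ∎
      where
      reach : ∀ {z} → two-step x z ≡ true → z ∈ concatMap outs (outs x)
      reach {z} e with some-⁻ {p = λ y → out x y ∧ out y z} e
      ... | y , e′ with ∧-true⁻ {out x y} e′
      ...   | xy , yz = ∈-concatMap⁺ outs (lose (out⇒∈outs xy) (out⇒∈outs yz))

  -- The pairs inside X that have a common in-neighbour are few: each vertex b outside X which exhibits a new
  -- pair {x , y} is contracted into x, which creates the edge xy. Every b accounts for at most d² pairs,
  -- and the number of contractions is bounded by the number of edges of the minor obtained on X.
  module _ (X : List V) (unique : Unique X) where

    -- The edges created when every `b` with `c b ≡ just x` is contracted into `x`. Edges of `G`
    -- with both ends in `X` are not automatically included.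
    via : (V → Maybe V) → V → V → Bool
    via c x y = some λ b → ⌊ Maybe-≡-dec _≟ᶠ_ (c b) (just x) ⌋ ∧ adj G b y

    via-⁻ : ∀ {c x y} → via c x y ≡ true → ∃ λ b → c b ≡ just x × adj G b y ≡ true
    via-⁻ {c} {x} {y} e with some-⁻ {p = λ b → ⌊ Maybe-≡-dec _≟ᶠ_ (c b) (just x) ⌋ ∧ adj G b y} e
    ... | b , e′ with ∧-true⁻ {⌊ Maybe-≡-dec _≟ᶠ_ (c b) (just x) ⌋} e′
    ...   | cb , a = b , ⌊⌋-true⁻ (Maybe-≡-dec _≟ᶠ_ (c b) (just x)) cb , a

    via-⁺ : ∀ {c x y b} → c b ≡ just x → adj G b y ≡ true → via c x y ≡ true
    via-⁺ {c} {x} {y} {b} cb a =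
      some-⁺ {p = λ b → ⌊ Maybe-≡-dec _≟ᶠ_ (c b) (just x) ⌋ ∧ adj G b y} {b} (∧-true⁺ (⌊⌋-true⁺ (Maybe-≡-dec _≟ᶠ_ (c b) (just x)) cb) a)

    missing : (V → Maybe V) → List V → V → V → Bool
    missing c L x y = simple (shared L) x y ∧ not (simple (via c) x y)

    -- The bound `few` charges `d * d` missing pairs to each edge of the minor and to each vertex of
    -- `L` in `X`. The latter cannot be contracted, since the vertices of `X` serve as centres.
    record Contraction (L : List V) : Set where
      field
        centre : V → Maybe V
        valid  : ∀ {b x} → centre b ≡ just x → b ∈ L × b ∉ X × x ∈ X × adj G b x ≡ true
        few    : edgeCount (missing centre L) X ≤
                 (edgeCount (simple (via centre)) X + count (λ b → ⌊ b ∈? X ⌋) L) * (d * d)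

    open Contraction

    both : V → V → V → Bool
    both b x y = out b x ∧ out b y

    both-≤ : ∀ b → edgeCount (both b) X ≤ d * d
    both-≤ b = ≤-trans (edgeCount-product (out b) X) (*-mono-≤ (outdegree b unique) (outdegree b unique))

    both-flip : ∀ {b x y} → both b x y ≡ true → both b y x ≡ true
    both-flip {b} {x} {y} e = trans (∧-comm (out b y) (out b x)) e

    missing-∷ : ∀ {c c′ b L} → (∀ {x y} → simple (via c) x y ≡ true → simple (via c′) x y ≡ true) →
                edgeCount (missing c′ (b ∷ L)) X ≤ edgeCount (missing c L) X + d * d
    missing-∷ {c} {c′} {b} {L} c⊆c′ = ≤-trans (edgeCount-mono-∨ X (λ _ _ → cover)) (+-monoʳ-≤ _ (both-≤ b))
      where
      cover : ∀ {x y} → missing c′ (b ∷ L) x y ≡ true → missing c L x y ≡ true ⊎ both b x y ≡ true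
      cover {x} {y} e with ∧-true⁻ {simple (shared (b ∷ L)) x y} e
      ... | sh , ¬v with simple-⁻ (shared (b ∷ L)) {x} {y} sh
      ...   | x≢y , s = classify s
        where
        still : not (simple (via c) x y) ≡ true
        still with simple (via c) x y in eq
        ... | false = refl
        ... | true  = ⊥-elim (true≢false (c⊆c′ eq) (not-true⁻ ¬v))
        classify : shared (b ∷ L) x y ≡ true ⊎ shared (b ∷ L) y x ≡ true → missing c L x y ≡ true ⊎ both b x y ≡ true
        classify (inj₁ s) with ∨-true⁻ {both b x y} s
        ... | inj₁ p = inj₂ p
        ... | inj₂ q = inj₁ (∧-true⁺ (simple-⁺ (shared L) x≢y (inj₁ q)) still)
        classify (inj₂ s) with ∨-true⁻ {both b y x} s
        ... | inj₁ p = inj₂ (both-flip {b} {y} {x} p)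
        ... | inj₂ q = inj₁ (∧-true⁺ (simple-⁺ (shared L) x≢y (inj₂ q)) still)

    -- Three cases for `b`: it lies in `X` and is charged itself; or all pairs of its out-neighbours
    -- in `X` are already edges of the minor and nothing new is missing; or it is contracted, and
    -- the edge gained pays for its pairs.
    contract-all : (L : List V) → Unique L → Contraction L
    contract-all [] _ = record { centre = λ _ → nothing ; valid = λ () ; few = ≤-trans (edgeCount-mono X none) (≤-trans (≤-reflexive (edgeCount-false X)) z≤n) }
      where
      none : ∀ {x y} → x ∈ X → y ∈ X → missing (λ _ → nothing) [] x y ≡ true → false ≡ true
      none {x} {y} _ _ e with simple-⁻ (shared []) {x} {y} (proj₁ (∧-true⁻ {simple (shared []) x y} e))
      ... | _ , inj₁ ()
      ... | _ , inj₂ ()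
    contract-all (b ∷ L) (b≢ ∷ uL) with contract-all L uL
    ... | s with b ∈? X
    ...   | yes b∈ = record
      { centre = centre s
      ; valid  = λ e → let (b∈L , r) = valid s e in there b∈L , r
      ; few    = begin
          edgeCount (missing (centre s) (b ∷ L)) X          ≤⟨ missing-∷ {centre s} {centre s} {b} {L} (λ e → e) ⟩
          edgeCount (missing (centre s) L) X + d * d        ≤⟨ +-monoˡ-≤ _ (few s) ⟩
          (m + k) * (d * d) + d * d                         ≡⟨ bump m k (d * d) ⟩
          (m + (1 + k)) * (d * d)                           ≡⟨ cong (λ i → (m + (𝟙 i + k)) * (d * d)) (≡-sym (⌊⌋-true⁺ (b ∈? X) b∈)) ⟩
          (m + count (λ b → ⌊ b ∈? X ⌋) (b ∷ L)) * (d * d)  ∎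
      }
      where
      open ≤-Reasoning
      m k : ℕ
      m = edgeCount (simple (via (centre s))) X
      k = count (λ b → ⌊ b ∈? X ⌋) L
      bump : ∀ m k e → (m + k) * e + e ≡ (m + (1 + k)) * e
      bump = solve-∀
    ...   | no b∉ with search² (λ x y → simple (both b) x y ∧ not (simple (via (centre s)) x y)) X
    ...     | inj₂ none = record
      { centre = centre s
      ; valid  = λ e → let (b∈L , r) = valid s e in there b∈L , r
      ; few    = begin
          edgeCount (missing (centre s) (b ∷ L)) X          ≤⟨ edgeCount-mono X old ⟩
          edgeCount (missing (centre s) L) X                ≤⟨ few s ⟩
          (m + count (λ b → ⌊ b ∈? X ⌋) L) * (d * d)        ≤⟨ *-monoˡ-≤ (d * d) (+-monoʳ-≤ m (m≤n+m _ (𝟙 ⌊ b ∈? X ⌋))) ⟩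
          (m + count (λ b → ⌊ b ∈? X ⌋) (b ∷ L)) * (d * d)  ∎
      }
      where
      open ≤-Reasoning
      m : ℕ
      m = edgeCount (simple (via (centre s))) X
      old : ∀ {x y} → x ∈ X → y ∈ X → missing (centre s) (b ∷ L) x y ≡ true → missing (centre s) L x y ≡ true
      old {x} {y} x∈ y∈ e with ∧-true⁻ {simple (shared (b ∷ L)) x y} e
      ... | sh , ¬v with simple-⁻ (shared (b ∷ L)) {x} {y} sh
      ...   | x≢y , r = ∧-true⁺ (simple-⁺ (shared L) x≢y ([ (λ q → inj₁ (pick q (inj₁ refl))) , (λ q → inj₂ (pick q (inj₂ refl))) ]′ r)) ¬v
        where
        pick : ∀ {p q} → shared (b ∷ L) p q ≡ true → (p , q) ≡ (x , y) ⊎ (p , q) ≡ (y , x) → shared L p q ≡ true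
        pick {p} {q} sb pq with ∨-true⁻ {both b p q} sb
        ... | inj₂ o = o
        pick {p} {q} sb (inj₁ refl) | inj₁ o =
          ⊥-elim (true≢false (∧-true⁺ (simple-⁺ (both b) x≢y (inj₁ o)) ¬v) (none x∈ y∈))
        pick {p} {q} sb (inj₂ refl) | inj₁ o =
          ⊥-elim (true≢false (∧-true⁺ (simple-⁺ (both b) x≢y (inj₂ o)) ¬v) (none x∈ y∈))
    ...     | inj₁ (x , y , x∈ , y∈ , e) = record
      { centre = c′
      ; valid  = valid′
      ; few    = begin
          edgeCount (missing c′ (b ∷ L)) X                                              ≤⟨ missing-∷ {c} {c′} {b} {L} (λ {p} {q} → c⊆c′ {p} {q}) ⟩
          edgeCount (missing c L) X + d * d                                             ≤⟨ +-monoˡ-≤ _ (few s) ⟩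
          (m + k) * (d * d) + d * d                                                     ≡⟨ bump m k (d * d) ⟩
          (suc m + k) * (d * d)                                                         ≤⟨ *-monoˡ-≤ (d * d) (+-mono-≤ more (m≤n+m k (𝟙 ⌊ b ∈? X ⌋))) ⟩
          (edgeCount (simple (via c′)) X + count (λ b → ⌊ b ∈? X ⌋) (b ∷ L)) * (d * d)  ∎
      }
      where
      open ≤-Reasoning
      c c′ : V → Maybe V
      c  = centre s
      c′ = update b (just x) c
      m k : ℕ
      m = edgeCount (simple (via c)) X
      k = count (λ b → ⌊ b ∈? X ⌋) L
      bump : ∀ m k e → (m + k) * e + e ≡ (suc m + k) * e
      bump = solve-∀
      new : x ≢ y × (both b x y ≡ true ⊎ both b y x ≡ true)
      new = simple-⁻ (both b) {x} {y} (proj₁ (∧-true⁻ {simple (both b) x y} e))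
      bxy : out b x ≡ true × out b y ≡ true
      bxy = [ ∧-true⁻ , (λ q → ∧-true⁻ (both-flip {b} {y} {x} q)) ]′ (proj₂ new)
      unseen : simple (via c) x y ≡ false
      unseen = not-true⁻ (proj₂ (∧-true⁻ {simple (both b) x y} e))
      -- All vertices contracted so far lie in `L`, which does not contain `b`, so the update at `b`
      -- keeps every earlier edge.
      via-mono : ∀ {p q} → via c p q ≡ true → via c′ p q ≡ true
      via-mono {p} {q} v with via-⁻ {c} {p} {q} v
      ... | b′ , cb′ , a = via-⁺ {c′} {p} {q} {b′} (trans (update-other (just x) c (λ b′≡b → All.lookup b≢ (proj₁ (valid s cb′)) (≡-sym b′≡b))) cb′) a
      c⊆c′ : ∀ {p q} → simple (via c) p q ≡ true → simple (via c′) p q ≡ true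
      c⊆c′ {p} {q} v with simple-⁻ (via c) {p} {q} v
      ... | p≢q , inj₁ r = simple-⁺ (via c′) p≢q (inj₁ (via-mono {p} {q} r))
      ... | p≢q , inj₂ r = simple-⁺ (via c′) p≢q (inj₂ (via-mono {q} {p} r))
      more : suc m ≤ edgeCount (simple (via c′)) X
      more = edgeCount-strict (simple-sym (via c)) (simple-sym (via c′)) (λ {p} {q} → c⊆c′ {p} {q}) x∈ y∈ (proj₁ new) unseen
        (simple-⁺ (via c′) (proj₁ new) (inj₁ (via-⁺ {c′} {x} {y} {b} (update-same b (just x) c) (out⇒adj (proj₂ bxy)))))
      valid′ : ∀ {b′ x′} → c′ b′ ≡ just x′ → b′ ∈ b ∷ L × b′ ∉ X × x′ ∈ X × adj G b′ x′ ≡ true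
      valid′ {b′} e′ with b′ ≟ᶠ b
      valid′ refl | yes refl = here refl , b∉ , x∈ , out⇒adj (proj₁ bxy)
      ... | no _ = let (b∈L , r) = valid s e′ in there b∈L , r

    -- A pair with a common in-neighbour is an edge of the contracted graph or missing. The
    -- contracted graph has no large clique minor either, hence few edges, and through `few` this
    -- limits the missing pairs as well.
    shared-sparse : edgeCount (simple (shared (allFin (n G)))) X ≤ length X * (2 ^ t + (2 ^ t + 1) * (d * d))
    shared-sparse = begin
      edgeCount (simple (shared (allFin (n G)))) X
        ≤⟨ edgeCount-mono-∨ X (λ {x} {y} _ _ → split {x} {y}) ⟩
      edgeCount (simple (via c)) X + edgeCount (missing c (allFin (n G))) X
        ≤⟨ +-monoʳ-≤ _ (few s) ⟩
      edgeCount (simple (via c)) X + (edgeCount (simple (via c)) X + count (λ b → ⌊ b ∈? X ⌋) (allFin (n G))) * (d * d)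
        ≤⟨ +-mono-≤ minor-sparse (*-monoˡ-≤ (d * d) (+-mono-≤ minor-sparse
             (count-≤-length X (Unique-allFin (n G)) (λ {b} _ → ⌊⌋-true⁻ (b ∈? X))))) ⟩
      length X * 2 ^ t + (length X * 2 ^ t + length X) * (d * d)
        ≡⟨ factor (length X) (2 ^ t) (d * d) ⟩
      length X * (2 ^ t + (2 ^ t + 1) * (d * d)) ∎
      where
      open ≤-Reasoning
      s : Contraction (allFin (n G))
      s = contract-all (allFin (n G)) (Unique-allFin (n G))
      c : V → Maybe V
      c = centre s
      factor : ∀ l a e → l * a + (l * a + l) * e ≡ l * (a + (a + 1) * e)
      factor = solve-∀
      split : ∀ {x y} → simple (shared (allFin (n G))) x y ≡ true → simple (via c) x y ≡ true ⊎ missing c (allFin (n G)) x y ≡ true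
      split {x} {y} e with simple (via c) x y
      ... | true  = inj₁ refl
      ... | false = inj₂ (∧-true⁺ e refl)
      ρ : V → Maybe V
      ρ g = if ⌊ g ∈? X ⌋ then just g else c g
      ρ-centre : ∀ {x} → x ∈ X → ρ x ≡ just x
      ρ-centre {x} x∈ rewrite ⌊⌋-true⁺ (x ∈? X) x∈ = refl
      ρ-outside : ∀ {b} → b ∉ X → ρ b ≡ c b
      ρ-outside {b} b∉ rewrite ⌊⌋-false⁺ (b ∈? X) b∉ = refl
      ρ-star : ∀ {g x} → ρ g ≡ just x → g ∈ allFin (n G) × (g ≡ x ⊎ adj G g x ≡ true)
      ρ-star {g} e with g ∈? X
      ρ-star {g} refl | yes _ = ∈-allFin g , inj₁ refl
      ... | no _ = let (g∈ , _ , _ , a) = valid s e in g∈ , inj₂ a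
      Joined : V → V → Set
      Joined x y = ∃ λ g → ∃ λ g′ → ρ g ≡ just x × ρ g′ ≡ just y × adj G g g′ ≡ true
      lift-via : ∀ {x y} → y ∈ X → via c x y ≡ true → Joined x y
      lift-via {x} {y} y∈ v with via-⁻ {c} {x} {y} v
      ... | b , cb , a = b , y , trans (ρ-outside (proj₁ (proj₂ (valid s cb)))) cb , ρ-centre y∈ , a
      turn : ∀ {x y} → Joined y x → Joined x y
      turn (g , g′ , p , q , a) = g′ , g , q , p , adj-sym G a
      ρ-lift : ∀ {x y} → x ∈ X → y ∈ X → simple (via c) x y ≡ true → Joined x y
      ρ-lift {x} {y} x∈ y∈ e = [ lift-via y∈ , (λ v → turn (lift-via x∈ v)) ]′ (proj₂ (simple-⁻ (via c) {x} {y} e))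
      minor-sparse : edgeCount (simple (via c)) X ≤ length X * 2 ^ t
      minor-sparse = cliqueMinor-free⇒sparse {t} {simpleGraph (n G) (via c)} unique λ k →
        free (StarContraction.pull-back G (via c) X (allFin (n G)) ρ ρ-centre ρ-star ρ-lift k)

  close : V → V → Bool
  close x y = adj G x y ∨ (shared (allFin (n G)) x y ∨ two-step x y)

  close-sparse : Sparse (simple close) (closeDensity t d)
  close-sparse X unique = begin
    edgeCount (simple close) X
      ≤⟨ edgeCount-mono-∨ {S = adj G} X (λ {x} {y} _ _ → split₁ {x} {y}) ⟩
    edgeCount (adj G) X + edgeCount (simple rest) X
      ≤⟨ +-monoʳ-≤ _ (edgeCount-mono-∨ X (λ {x} {y} _ _ → split₂ {x} {y})) ⟩
    edgeCount (adj G) X + (edgeCount (simple (shared (allFin (n G)))) X + edgeCount (simple two-step) X)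
      ≤⟨ +-mono-≤ (cliqueMinor-free⇒sparse {t} {G} unique (λ k → free (widen k)))
                  (+-mono-≤ (shared-sparse X unique) (two-step-sparse X unique)) ⟩
    length X * 2 ^ t + (length X * (2 ^ t + (2 ^ t + 1) * (d * d)) + length X * (d * d))
      ≡⟨ factor (length X) (2 ^ t) (2 ^ t + (2 ^ t + 1) * (d * d)) (d * d) ⟩
    length X * closeDensity t d ∎
    where
    open ≤-Reasoning
    rest : V → V → Bool
    rest x y = shared (allFin (n G)) x y ∨ two-step x y
    factor : ∀ l a b c → l * a + (l * b + l * c) ≡ l * (a + (b + c))
    factor = solve-∀
    split₁ : ∀ {x y} → simple close x y ≡ true → adj G x y ≡ true ⊎ simple rest x y ≡ true
    split₁ {x} {y} e with simple-⁻ close {x} {y} e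
    ... | x≢y , inj₁ c with ∨-true⁻ {adj G x y} c
    ...   | inj₁ a = inj₁ a
    ...   | inj₂ r = inj₂ (simple-⁺ rest x≢y (inj₁ r))
    split₁ {x} {y} e | x≢y , inj₂ c with ∨-true⁻ {adj G y x} c
    ...   | inj₁ a = inj₁ (adj-sym G a)
    ...   | inj₂ r = inj₂ (simple-⁺ rest x≢y (inj₂ r))
    split₂ : ∀ {x y} → simple rest x y ≡ true → simple (shared (allFin (n G))) x y ≡ true ⊎ simple two-step x y ≡ true
    split₂ {x} {y} e with simple-⁻ rest {x} {y} e
    ... | x≢y , inj₁ c with ∨-true⁻ {shared (allFin (n G)) x y} c
    ...   | inj₁ a = inj₁ (simple-⁺ (shared (allFin (n G))) x≢y (inj₁ a))
    ...   | inj₂ r = inj₂ (simple-⁺ two-step x≢y (inj₁ r))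
    split₂ {x} {y} e | x≢y , inj₂ c with ∨-true⁻ {shared (allFin (n G)) y x} c
    ...   | inj₁ a = inj₁ (simple-⁺ (shared (allFin (n G))) x≢y (inj₂ a))
    ...   | inj₂ r = inj₂ (simple-⁺ two-step x≢y (inj₂ r))

-- Odd colourings of nested partitions

parity : ∀ m → Odd m ⊎ ∃ λ k → m ≡ 2 * k
parity zero = inj₂ (0 , refl)
parity (suc m) with parity m
... | inj₁ (k , e) = inj₂ (suc k , trans (cong suc e) (double k))
  where
  double : ∀ k → suc (suc (2 * k)) ≡ 2 * suc k
  double = solve-∀
... | inj₂ (k , e) = inj₁ (k , cong suc e)

even-∸-odd : ∀ {k a b} → 2 * k ≡ a + b → Odd a → Odd b
even-∸-odd {k} {a} {b} e (i , a≡) with parity b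
... | inj₁ o = o
... | inj₂ (j , b≡) = ⊥-elim (even≢odd k (i + j) (trans e (trans (cong₂ _+_ a≡ b≡) (regroup i j))))
  where
  regroup : ∀ i j → suc (2 * i) + 2 * j ≡ suc (2 * (i + j))
  regroup = solve-∀

count-∈ : {p : A → Bool} {xs : List A} {x : A} → x ∈ xs → p x ≡ true → 1 ≤ count p xs
count-∈ (here refl) e rewrite e = s≤s z≤n
count-∈ {p = p} {y ∷ _} (there x∈) e = ≤-trans (count-∈ x∈ e) (m≤n+m _ (𝟙 (p y)))

count-singleton : (p : Fin N → Bool) {x : Fin N} → p x ≡ true → (∀ {y} → p y ≡ true → y ≡ x) → count p (allFin N) ≡ 1
count-singleton {N} p {x} px only = ≤-antisym
  (count-≤-length (x ∷ []) (Unique-allFin N) (λ _ e → here (only e)))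
  (count-∈ (∈-allFin x) px)

odd-1 : ∀ {m} → m ≡ 1 → Odd m
odd-1 refl = 0 , refl

-- The partition with index `j` is given by the map `key j` to names of classes; the one with index
-- 0 is discrete, and each is refined by its predecessor.
module NestedPartitions {N : ℕ} {K : Set} (_≟ᵏ_ : DecidableEquality K) (key : ℕ → Fin N → K)
  (finest : ∀ {x y} → key 0 x ≡ key 0 y → x ≡ y)
  (coarsen : ∀ j {x y} → key j x ≡ key j y → key (suc j) x ≡ key (suc j) y) where

  cell : ∀ {q} → ℕ → (Fin N → Fin q) → K → Fin q → Fin N → Bool
  cell j c k i x = ⌊ key j x ≟ᵏ k ⌋ ∧ ⌊ c x ≟ᶠ i ⌋

  cell-⁻ : ∀ {q} j {c : Fin N → Fin q} {k i x} → cell j c k i x ≡ true → key j x ≡ k × c x ≡ i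
  cell-⁻ j {c} {k} {i} {x} e = let (a , b) = ∧-true⁻ {⌊ key j x ≟ᵏ k ⌋} e in
    ⌊⌋-true⁻ (key j x ≟ᵏ k) a , ⌊⌋-true⁻ (c x ≟ᶠ i) b

  cell-⁺ : ∀ {q} j {c : Fin N → Fin q} {k i x} → key j x ≡ k → c x ≡ i → cell j c k i x ≡ true
  cell-⁺ j {c} {k} {i} {x} a b = ∧-true⁺ (⌊⌋-true⁺ (key j x ≟ᵏ k) a) (⌊⌋-true⁺ (c x ≟ᶠ i) b)

  size : ∀ {q} → ℕ → (Fin N → Fin q) → K → Fin q → ℕ
  size j c k i = count (cell j c k i) (allFin N)

  OddUpTo : ∀ {q} → ℕ → (Fin N → Fin q) → Set
  OddUpTo m c = ∀ {j} → j ≤ m → ∀ x → Odd (size j c (key j x) (c x))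

  coarsen-≤ : ∀ {j m} → j ≤ m → ∀ {x y} → key j x ≡ key j y → key m x ≡ key m y
  coarsen-≤ {j} {zero}  z≤n e = e
  coarsen-≤ {j} {suc m} j≤ e with m≤n⇒m<n∨m≡n j≤
  ... | inj₁ j<    = coarsen m (coarsen-≤ (≤-pred j<) e)
  ... | inj₂ refl = e

  -- One more (coarser) partition: in every class where a colour i occurs an even number of times, the i-coloured
  -- elements of a single class of the previous partition are recoloured. Their number is odd, so both parts are odd.
  module Step {q : ℕ} (m : ℕ) (c : Fin N → Fin q) (odd : OddUpTo m c) where

    members : K → Fin q → List (Fin N)
    members k i = filter (λ x → cell (suc m) c k i x ≟ᵇ true) (allFin N)

    -- The class of partition `m` whose members of colour `i` are to be recoloured, chosen as that
    -- of the first member. An empty cell has even size too, and `head` then gives `nothing`.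
    marked : K → Fin q → Maybe K
    marked k i with parity (size (suc m) c k i)
    ... | inj₁ _ = nothing
    ... | inj₂ _ = mapᵐ (key m) (head (members k i))

    recoloured : Fin N → Bool
    recoloured x = ⌊ Maybe-≡-dec _≟ᵏ_ (marked (key (suc m) x) (c x)) (just (key m x)) ⌋

    bit : Bool → Fin 2
    bit b = if b then suc zero else zero

    bit-injective : ∀ {a b} → bit a ≡ bit b → a ≡ b
    bit-injective {true}  {true}  _ = refl
    bit-injective {false} {false} _ = refl

    c′ : Fin N → Fin (2 * q)
    c′ x = combine (bit (recoloured x)) (c x)

    c′-⁻ : ∀ {x y} → c′ x ≡ c′ y → recoloured x ≡ recoloured y × c x ≡ c y
    c′-⁻ {x} {y} e = let (a , b) = combine-injective (bit (recoloured x)) (c x) (bit (recoloured y)) (c y) e in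
      bit-injective a , b

    c′-⁺ : ∀ {x y} → recoloured x ≡ recoloured y → c x ≡ c y → c′ x ≡ c′ y
    c′-⁺ a b = cong₂ (λ u v → combine (bit u) v) a b

    -- Recolouring is decided by the class in partition `m` and the old colour. It therefore splits
    -- no colour class within a class of partition `m` or of a finer one.
    recoloured-cong : ∀ {x y} → key m x ≡ key m y → c x ≡ c y → recoloured x ≡ recoloured y
    recoloured-cong e e′ rewrite coarsen m e | e | e′ = refl

    marked-spec : ∀ x → (Odd (size (suc m) c (key (suc m) x) (c x)) × marked (key (suc m) x) (c x) ≡ nothing) ⊎
      (∃ λ h → size (suc m) c (key (suc m) x) (c x) ≡ 2 * h) ×
      (∃ λ f → key (suc m) f ≡ key (suc m) x × c f ≡ c x × marked (key (suc m) x) (c x) ≡ just (key m f))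
    marked-spec x with parity (size (suc m) c (key (suc m) x) (c x))
    ... | inj₁ o = inj₁ (o , refl)
    ... | inj₂ h with members (key (suc m) x) (c x) in eq
    ...   | [] = contradiction (subst (x ∈_) eq (∈-filter⁺ (λ y → cell (suc m) c (key (suc m) x) (c x) y ≟ᵇ true) (∈-allFin x) (cell-⁺ (suc m) {c} refl refl))) λ ()
    ...   | f ∷ _ = inj₂ (h , f , proj₁ f-in , proj₂ f-in , refl)
      where
      f-in : key (suc m) f ≡ key (suc m) x × c f ≡ c x
      f-in = cell-⁻ (suc m) {c} (proj₂ (∈-filter⁻ (λ y → cell (suc m) c (key (suc m) x) (c x) y ≟ᵇ true) {xs = allFin N}
        (subst (f ∈_) (≡-sym eq) (here refl))))

    -- If the old count is odd, nothing is recoloured. Otherwise `x` belongs either to the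
    -- recoloured part, a cell of partition `m` and so odd, or to its complement in a set of even
    -- size.
    odd-top : ∀ x → Odd (size (suc m) c′ (key (suc m) x) (c′ x))
    odd-top x with marked-spec x
    ... | inj₁ (o , none) = subst Odd (count-cong (allFin N) same) o
      where
      plain : ∀ y → key (suc m) y ≡ key (suc m) x → c y ≡ c x → recoloured y ≡ false
      plain y e e′ rewrite e | e′ | none = refl
      same : ∀ y → cell (suc m) c (key (suc m) x) (c x) y ≡ cell (suc m) c′ (key (suc m) x) (c′ x) y
      same y = bool-ext
        (λ r → let (e , e′) = cell-⁻ (suc m) {c} r in
          cell-⁺ (suc m) {c′} e (c′-⁺ (trans (plain y e e′) (≡-sym (plain x refl refl))) e′))
        (λ r → let (e , e′) = cell-⁻ (suc m) {c′} r in cell-⁺ (suc m) {c} e (proj₂ (c′-⁻ e′)))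
    ... | inj₂ ((h , even) , f , fk , fc , is-f) with key m x ≟ᵏ key m f
    ...   | yes x~f = subst Odd (count-cong (allFin N) same) (odd ≤-refl x)
      where
      re : ∀ y → key (suc m) y ≡ key (suc m) x → c y ≡ c x → recoloured y ≡ true → key m y ≡ key m x
      re y e e′ r = trans (≡-sym (just-injective (trans (≡-sym (trans (cong₂ marked e e′) is-f))
        (⌊⌋-true⁻ (Maybe-≡-dec _≟ᵏ_ (marked (key (suc m) y) (c y)) (just (key m y))) r)))) (≡-sym x~f)
      re-x : recoloured x ≡ true
      re-x = ⌊⌋-true⁺ (Maybe-≡-dec _≟ᵏ_ (marked (key (suc m) x) (c x)) (just (key m x))) (trans is-f (cong just (≡-sym x~f)))
      same : ∀ y → cell m c (key m x) (c x) y ≡ cell (suc m) c′ (key (suc m) x) (c′ x) y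
      same y = bool-ext
        (λ r → let (e , e′) = cell-⁻ m {c} r in cell-⁺ (suc m) {c′} (coarsen m e) (c′-⁺ (recoloured-cong e e′) e′))
        (λ r → let (e , e′) = cell-⁻ (suc m) {c′} r ; (e₁ , e₂) = c′-⁻ e′ in cell-⁺ m {c} (re y e e₂ (trans e₁ re-x)) e₂)
    ...   | no x≁f = even-∸-odd {h}
            (trans (≡-sym even) (trans (count-split (cell (suc m) c (key (suc m) x) (c x)) (cell m c (key m f) (c f)) (allFin N))
              (cong₂ _+_ (count-cong (allFin N) inner) (count-cong (allFin N) outer))))
            (odd ≤-refl f)
      where
      plain : ∀ y → key (suc m) y ≡ key (suc m) x → c y ≡ c x → key m y ≢ key m f → recoloured y ≡ false
      plain y e e′ y≁f = ⌊⌋-false⁺ (Maybe-≡-dec _≟ᵏ_ (marked (key (suc m) y) (c y)) (just (key m y)))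
        (λ r → y≁f (≡-sym (just-injective (trans (≡-sym (trans (cong₂ marked e e′) is-f)) r))))
      inner : ∀ y → cell (suc m) c (key (suc m) x) (c x) y ∧ cell m c (key m f) (c f) y ≡ cell m c (key m f) (c f) y
      inner y = bool-ext (λ r → proj₂ (∧-true⁻ {cell (suc m) c (key (suc m) x) (c x) y} r))
        (λ r → let (e , e′) = cell-⁻ m {c} r in ∧-true⁺ (cell-⁺ (suc m) {c} (trans (coarsen m e) fk) (trans e′ fc)) r)
      outer : ∀ y → cell (suc m) c (key (suc m) x) (c x) y ∧ not (cell m c (key m f) (c f) y) ≡ cell (suc m) c′ (key (suc m) x) (c′ x) y
      outer y = bool-ext
        (λ r → let (r₁ , r₂) = ∧-true⁻ {cell (suc m) c (key (suc m) x) (c x) y} r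
                   (e , e′) = cell-⁻ (suc m) {c} r₁
               in cell-⁺ (suc m) {c′} e (c′-⁺ (trans (plain y e e′ (λ y~f → true≢false (cell-⁺ m {c} y~f (trans e′ (≡-sym fc))) (not-true⁻ r₂)))
                    (≡-sym (plain x refl refl x≁f))) e′))
        (λ r → let (e , e′) = cell-⁻ (suc m) {c′} r ; (e₁ , e₂) = c′-⁻ e′
               in ∧-true⁺ (cell-⁺ (suc m) {c} e e₂) (not-cell y (trans e₁ (plain x refl refl x≁f)) e e₂))
        where
        not-cell : ∀ y → recoloured y ≡ false → key (suc m) y ≡ key (suc m) x → c y ≡ c x → not (cell m c (key m f) (c f) y) ≡ true
        not-cell y ¬re e e′ with cell m c (key m f) (c f) y in eq
        ... | false = refl
        ... | true  = ⊥-elim (true≢false (⌊⌋-true⁺ (Maybe-≡-dec _≟ᵏ_ (marked (key (suc m) y) (c y)) (just (key m y)))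
                (trans (cong₂ marked e e′) (trans is-f (cong just (≡-sym (proj₁ (cell-⁻ m {c} eq))))))) ¬re)

    odd-below : ∀ {j} → j ≤ m → ∀ x → Odd (size j c′ (key j x) (c′ x))
    odd-below {j} j≤ x = subst Odd (count-cong (allFin N) same) (odd j≤ x)
      where
      same : ∀ y → cell j c (key j x) (c x) y ≡ cell j c′ (key j x) (c′ x) y
      same y = bool-ext
        (λ r → let (e , e′) = cell-⁻ j {c} r in cell-⁺ j {c′} e (c′-⁺ (recoloured-cong (coarsen-≤ j≤ e) e′) e′))
        (λ r → let (e , e′) = cell-⁻ j {c′} r in cell-⁺ j {c} e (proj₂ (c′-⁻ e′)))

  -- In the discrete partition one colour suffices; each further partition doubles the number of
  -- colours.
  odd-colouring : ∀ m → ∃ λ (c : Fin N → Fin (2 ^ m)) → OddUpTo m c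
  odd-colouring zero = c₀ , λ { z≤n x → odd-1 (count-singleton (cell 0 c₀ (key 0 x) zero)
    (cell-⁺ 0 {c₀} {i = zero} {x = x} refl refl) (λ {y} e → finest (proj₁ (cell-⁻ 0 {c₀} {i = zero} {x = y} e)))) }
    where
    c₀ : Fin N → Fin 1
    c₀ _ = zero
  odd-colouring (suc m) with odd-colouring m
  ... | c , odd = c′ , λ {j} j≤ → [ (λ j< → odd-below (≤-pred j<)) , (λ { refl → odd-top }) ]′ (m≤n⇒m<n∨m≡n j≤)
    where open Step m c odd

-- The strong odd colouring

-- The number of lists of length at most `d` over `p` letters.
codes : ℕ → ℕ → ℕ
codes p zero    = 1
codes p (suc d) = suc (p * codes p d)

encode : ∀ {p} d → List (Fin p) → Fin (codes p d)
encode zero    _       = zero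
encode (suc d) []      = zero
encode (suc d) (x ∷ l) = suc (combine x (encode d l))

encode-injective : ∀ {p} d {l l′ : List (Fin p)} → length l ≤ d → length l′ ≤ d → encode d l ≡ encode d l′ → l ≡ l′
encode-injective zero    {[]}    {[]}     _ _ _ = refl
encode-injective (suc d) {[]}    {[]}     _ _ _ = refl
encode-injective (suc d) {x ∷ l} {x′ ∷ l′} (s≤s l≤) (s≤s l′≤) e
  with combine-injective x (encode d l) x′ (encode d l′) (suc-injectiveᶠ e)
... | refl , e′ = cong (x ∷_) (encode-injective d l≤ l′≤ e′)

drop-suc : ∀ j (l : List A) → drop (suc j) l ≡ drop 1 (drop j l)
drop-suc zero    l       = refl
drop-suc (suc j) []      = refl
drop-suc (suc j) (_ ∷ l) = drop-suc j l

∈-drop⁻ : ∀ j {l : List A} {x} → x ∈ drop j l → x ∈ l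
∈-drop⁻ zero x∈ = x∈
∈-drop⁻ (suc j) {_ ∷ _} x∈ = there (∈-drop⁻ j x∈)

∈-drop⁺ : {l : List A} {x : A} → x ∈ l → ∃ λ j → j < length l × ∃ λ r → drop j l ≡ x ∷ r
∈-drop⁺ (here refl) = 0 , s≤s z≤n , _ , refl
∈-drop⁺ (there x∈) = let (j , j< , r , e) = ∈-drop⁺ x∈ in suc j , s≤s j< , r , e

-- If each entry of a list records its own colour and the position of its successor among boundedly many
-- candidates, then the trace determines the list from any of its entries onwards.
module Trace {e : ℕ} (κ : Fin N → Fin (suc e)) (back : Fin N → List (Fin N)) (back-≤ : ∀ x → length (back x) ≤ e) where

  index : Fin N → Fin N → Fin (suc e)
  index x = proj₁ (local-index (back x) e (back-≤ x))

  next : Fin N → List (Fin N) → Fin (suc e)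
  -- Zero can also be a genuine index; the end of a list is recognised from the length of the trace
  -- instead.
  next x []      = zero
  next x (y ∷ _) = index x y

  trace : List (Fin N) → List (Fin (suc e * suc e))
  trace []      = []
  trace (x ∷ l) = combine (κ x) (next x l) ∷ trace l

  length-trace : ∀ l → length (trace l) ≡ length l
  length-trace []      = refl
  length-trace (_ ∷ l) = cong suc (length-trace l)

  Backed Rainbow : List (Fin N) → Set
  Backed  = AllPairs (λ x y → y ∈ back x)
  Rainbow = AllPairs (λ x y → κ x ≢ κ y)

  trace-κ : ∀ {x y l l′} → trace (x ∷ l) ≡ trace (y ∷ l′) → κ x ≡ κ y
  trace-κ {x} {y} {l} {l′} eq = combine-injectiveˡ (κ x) (next x l) (κ y) (next y l′) (∷-injectiveˡ eq)

  -- Both successors of `x` lie in `back x`, where equal indices force equality; the argument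
  -- continues from the common successor.
  trace-injective : ∀ {x l l′} → Backed (x ∷ l) → Backed (x ∷ l′) → trace (x ∷ l) ≡ trace (x ∷ l′) → l ≡ l′
  trace-injective {l = []}    {[]}     _ _ _ = refl
  trace-injective {l = []}    {_ ∷ _}  _ _ eq = contradiction (∷-injectiveʳ eq) λ ()
  trace-injective {l = _ ∷ _} {[]}     _ _ eq = contradiction (∷-injectiveʳ eq) λ ()
  trace-injective {x} {y ∷ l} {y′ ∷ l′} ((y∈ ∷ _) ∷ b) ((y′∈ ∷ _) ∷ b′) eq
    with proj₂ (local-index (back x) e (back-≤ x)) y∈ y′∈
           (combine-injectiveʳ (κ x) (index x y) (κ x) (index x y′) (∷-injectiveˡ eq))
  ... | refl = cong (y ∷_) (trace-injective b b′ (∷-injectiveʳ eq))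

  -- Equal traces show the same colours position by position, and within a list the colours are
  -- distinct, so `v` has the same position in both lists. From `v` on, the trace determines the
  -- list.
  drop-determined : ∀ j {l l′ v r} → Backed l → Backed l′ → Rainbow l → Rainbow l′ → trace l ≡ trace l′ →
                    drop j l ≡ v ∷ r → v ∈ l′ → drop j l′ ≡ v ∷ r
  drop-determined zero {v ∷ r} {.v ∷ r′} b b′ _ _ eq refl (here refl) = cong (v ∷_) (≡-sym (trace-injective b b′ eq))
  drop-determined zero {v ∷ r} {x′ ∷ r′} b b′ _ (κ≢ ∷ _) eq refl (there v∈) =
    ⊥-elim (All.lookup κ≢ v∈ (≡-sym (trace-κ {v} {x′} {r} {r′} eq)))
  drop-determined (suc j) {x ∷ l} {v ∷ l′} _ _ (κ≢ ∷ _) _ eq at (here refl) =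
    ⊥-elim (All.lookup κ≢ (∈-drop⁻ j (subst (v ∈_) (≡-sym at) (here refl))) (trace-κ {x} {v} {l} {l′} eq))
  drop-determined (suc j) {x ∷ l} {x′ ∷ l′} (_ ∷ b) (_ ∷ b′) (_ ∷ k) (_ ∷ k′) eq at (there v∈) =
    drop-determined j b b′ k k′ (∷-injectiveʳ eq) at v∈

-- The number of labels: a colour of `κ` together with a trace of length at most `d` over
-- `suc e * suc e` letters.
traceColours : ℕ → ℕ → ℕ
traceColours d e = suc e * codes (suc e * suc e) d

module Colouring (t : ℕ) (G : Graph) (free : ¬ CliqueMinorIn t G (allFin (n G)))
                 (d : ℕ) (outs : Fin (n G) → List (Fin (n G))) (outs-≤ : ∀ x → length (outs x) ≤ d)
                 (oriented : ∀ {x y} → adj G x y ≡ true → y ∈ outs x ⊎ x ∈ outs y)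
                 (e : ℕ) (ordering : Ordering (simple (Orientation.close t G free d outs outs-≤)) e (allFin (n G)))
                 (κ : Fin (n G) → Fin (suc e))
                 (κ-proper : ∀ {x y} → simple (Orientation.close t G free d outs outs-≤) x y ≡ true → κ x ≢ κ y) where

  open Orientation t G free d outs outs-≤

  open Trace κ (back ordering) (back-≤ ordering)

  order-unique : Unique (order ordering)
  order-unique = Unique-resp-↭ (↭-sym (order-↭ ordering)) (Unique-allFin (n G))

  out? : ∀ b x → Dec (out b x ≡ true)
  out? b x = out b x ≟ᵇ true

  O : V → List V
  O b = filter (out? b) (order ordering)

  ∈O⁺ : ∀ {b x} → out b x ≡ true → x ∈ O b
  ∈O⁺ {b} {x} o = ∈-filter⁺ (out? b) (∈-resp-↭ (↭-sym (order-↭ ordering)) (∈-allFin x)) o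

  ∈O⁻ : ∀ {b x} → x ∈ O b → out b x ≡ true
  ∈O⁻ {b} x∈ = proj₂ (∈-filter⁻ (out? b) {xs = order ordering} x∈)

  O-≤ : ∀ b → length (O b) ≤ d
  O-≤ b = subst (_≤ d) (≡-sym (length-filter-count (out b) (order ordering))) (outdegree b order-unique)

  out-out-close : ∀ {b x y} → out b x ≡ true → out b y ≡ true → x ≢ y → simple close x y ≡ true
  out-out-close {b} {x} {y} bx by x≢y = simple-⁺ close x≢y
    (inj₁ (∨-true⁺ʳ {adj G x y} (∨-true⁺ˡ (shared-⁺ (∈-allFin b) bx by))))

  out-in-close : ∀ {b x y} → out b x ≡ true → out y b ≡ true → x ≢ y → simple close x y ≡ true
  out-in-close {b} {x} {y} bx yb x≢y = simple-⁺ close x≢y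
    (inj₂ (∨-true⁺ʳ {adj G y x} (∨-true⁺ʳ {shared (allFin (n G)) y x}
      (some-⁺ {p = λ z → out y z ∧ out z x} {b} (∧-true⁺ yb bx)))))

  adj-close : ∀ {x y} → adj G x y ≡ true → simple close x y ≡ true
  adj-close a = simple-⁺ close (adj⇒≢ G a) (inj₁ (∨-true⁺ˡ a))

  adj⇒out : ∀ {x y} → adj G x y ≡ true → out x y ≡ true ⊎ out y x ≡ true
  adj⇒out {x} {y} a with oriented a
  ... | inj₁ y∈ = inj₁ (∧-true⁺ a (⌊⌋-true⁺ (y ∈? outs x) y∈))
  ... | inj₂ x∈ = inj₂ (∧-true⁺ (adj-sym G a) (⌊⌋-true⁺ (x ∈? outs y) x∈))

  O-unique : ∀ b → Unique (O b)
  O-unique b = Unique-filter⁺ (out? b) order-unique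

  O-rainbow : ∀ b → Rainbow (O b)
  O-rainbow b = AllPairs-map-∈ (λ x∈ y∈ x≢y → κ-proper (out-out-close (∈O⁻ x∈) (∈O⁻ y∈) x≢y)) (O-unique b)

  O-backed : ∀ b → Backed (O b)
  O-backed b = AllPairs-map-∈ (λ x∈ y∈ (x≢y , f) → f (out-out-close (∈O⁻ x∈) (∈O⁻ y∈) x≢y))
    (AllPairs-zip (O-unique b , AllPairs-filter⁺ (out? b) (back-edge ordering)))

  label : V → Fin (traceColours d e)
  label b = combine (κ b) (encode d (trace (O b)))

  label⇒κ : ∀ {b b′} → label b ≡ label b′ → κ b ≡ κ b′
  label⇒κ {b} {b′} eq = combine-injectiveˡ (κ b) (encode d (trace (O b))) (κ b′) (encode d (trace (O b′))) eq

  label⇒trace : ∀ {b b′} → label b ≡ label b′ → trace (O b) ≡ trace (O b′)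
  label⇒trace {b} {b′} eq = encode-injective d (bounded b) (bounded b′)
    (combine-injectiveʳ (κ b) (encode d (trace (O b))) (κ b′) (encode d (trace (O b′))) eq)
    where
    bounded : ∀ b → length (trace (O b)) ≤ d
    bounded b = subst (_≤ d) (≡-sym (length-trace (O b))) (O-≤ b)

  Key : Set
  Key = Fin (traceColours d e) × List V

  -- Index 0 is taken by the discrete partition, so agreement from position `j` on has index
  -- `suc j`. The label is part of the key, so that all members of a class share it.
  key : ℕ → V → Key
  key zero    b = label b , b ∷ []
  key (suc j) b = label b , drop j (O b)

  finest : ∀ {x y} → key 0 x ≡ key 0 y → x ≡ y
  finest eq = ∷-injectiveˡ (cong proj₂ eq)

  coarsen : ∀ j {x y} → key j x ≡ key j y → key (suc j) x ≡ key (suc j) y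
  coarsen zero eq with finest eq
  ... | refl = refl
  coarsen (suc j) {x} {y} eq = cong₂ _,_ (cong proj₁ eq)
    (trans (drop-suc j (O x)) (trans (cong (drop 1) (cong proj₂ eq)) (≡-sym (drop-suc j (O y)))))

  open NestedPartitions (×-≡-dec _≟ᶠ_ (List-≡-dec _≟ᶠ_)) key finest coarsen

  module _ {q : ℕ} (c : V → Fin q) (odd : OddUpTo d c) where

    φ : V → Fin (traceColours d e * q)
    φ b = combine (label b) (c b)

    φ-⁻ : ∀ {x y} → φ x ≡ φ y → label x ≡ label y × c x ≡ c y
    φ-⁻ {x} {y} = combine-injective (label x) (c x) (label y) (c y)

    φ⇒κ : ∀ {x y} → φ x ≡ φ y → κ x ≡ κ y
    φ⇒κ eq = label⇒κ (proj₁ (φ-⁻ eq))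

    sees : V → Fin (traceColours d e * q) → V → Bool
    sees v i u = adj G v u ∧ ⌊ φ u ≟ᶠ i ⌋

    sees-⁻ : ∀ {v i u} → sees v i u ≡ true → adj G v u ≡ true × φ u ≡ i
    sees-⁻ {v} {i} {u} s = let (a , b) = ∧-true⁻ {adj G v u} s in a , ⌊⌋-true⁻ (φ u ≟ᶠ i) b

    sees-⁺ : ∀ {v i u} → adj G v u ≡ true → φ u ≡ i → sees v i u ≡ true
    sees-⁺ {v} {i} {u} a b = ∧-true⁺ a (⌊⌋-true⁺ (φ u ≟ᶠ i) b)

    -- With `v` at position `j` of `O b`, the neighbours of `v` coloured like `b` form exactly the
    -- cell of `b` in the partition with index `suc j`.
    in-neighbours-odd : ∀ {v b} → out b v ≡ true → (∀ {u} → sees v (φ b) u ≡ true → out u v ≡ true) →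
                        Odd (count (sees v (φ b)) (allFin (n G)))
    in-neighbours-odd {v} {b} bv all-in with ∈-drop⁺ (∈O⁺ bv)
    -- From `j < length (O b)` follows `suc j ≤ d`, so this partition is among those on which `c` is
    -- odd.
    ... | j , j< , r , at = subst Odd (count-cong (allFin (n G)) same)
            (odd (≤-trans j< (O-≤ b)) b)
      where
      same : ∀ u → cell (suc j) c (key (suc j) b) (c b) u ≡ sees v (φ b) u
      same u = bool-ext
        (λ s → let (k , cu) = cell-⁻ (suc j) {c} {x = u} s
                   v∈ = ∈-drop⁻ j (subst (v ∈_) (≡-sym (trans (cong proj₂ k) at)) (here refl))
               in sees-⁺ (adj-sym G (out⇒adj (∈O⁻ v∈))) (cong₂ combine (cong proj₁ k) cu))
        (λ s → let (l , cu) = φ-⁻ (proj₂ (sees-⁻ {v} {φ b} {u} s))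
                   at′ = drop-determined j (O-backed b) (O-backed u) (O-rainbow b) (O-rainbow u)
                           (≡-sym (label⇒trace l)) at (∈O⁺ (all-in s))
               in cell-⁺ (suc j) {c} {x = u} (cong₂ _,_ l (trans at′ (≡-sym at))) cu)

    -- Adjacent vertices differ already in `κ`. An out-neighbour `w` of `v` is the only neighbour of
    -- its colour: any other neighbour `u` shares the in-neighbour `v` with `w` or starts a directed
    -- path through `v` to `w`, so `κ` separates them. Colours not seen on out-neighbours occur only
    -- on in-neighbours.
    φ-strongOdd : IsStrongOddColouring G (traceColours d e * q) φ
    φ-strongOdd = (λ u v a same → κ-proper (adj-close a) (φ⇒κ same)) ,
      λ v i → subst (λ m → m ≡ 0 ⊎ Odd m) (≡-sym (length-filterᵇ (sees v i) (allFin (n G)))) (classify v i)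
      where
      classify : ∀ v i → count (sees v i) (allFin (n G)) ≡ 0 ⊎ Odd (count (sees v i) (allFin (n G)))
      classify v i with search (λ w → out v w ∧ ⌊ φ w ≟ᶠ i ⌋) (allFin (n G))
      ... | inj₁ (w , _ , s) = inj₂ (odd-1 (count-singleton (sees v i) (sees-⁺ (out⇒adj vw) φw) only))
        where
        vw : out v w ≡ true
        vw = proj₁ (∧-true⁻ {out v w} s)
        φw : φ w ≡ i
        φw = ⌊⌋-true⁻ (φ w ≟ᶠ i) (proj₂ (∧-true⁻ {out v w} s))
        only : ∀ {u} → sees v i u ≡ true → u ≡ w
        only {u} su with u ≟ᶠ w
        ... | yes u≡w = u≡w
        ... | no u≢w with sees-⁻ {v} {i} {u} su
        ...   | a , φu with adj⇒out a
        ...     | inj₁ vu = ⊥-elim (κ-proper (out-out-close vu vw u≢w) (φ⇒κ (trans φu (≡-sym φw))))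
        ...     | inj₂ uv = ⊥-elim (κ-proper (out-in-close vw uv (u≢w ∘ ≡-sym)) (φ⇒κ (trans φw (≡-sym φu))))
      ... | inj₂ no-out with search (sees v i) (allFin (n G))
      ...   | inj₂ none = inj₁ (count-false (allFin (n G)) none)
      ...   | inj₁ (b , _ , s) with sees-⁻ {v} {i} {b} s
      ...     | _ , refl = inj₂ (in-neighbours-odd (all-in s) all-in)
        where
        all-in : ∀ {u} → sees v (φ b) u ≡ true → out u v ≡ true
        all-in {u} su with sees-⁻ {v} {φ b} {u} su
        ... | a , φu with adj⇒out a
        ...   | inj₂ uv = uv
        ...   | inj₁ vu = ⊥-elim (true≢false (∧-true⁺ vu (⌊⌋-true⁺ (φ u ≟ᶠ φ b) φu)) (no-out (∈-allFin u)))

  strongOdd-bounded : χso≤ G (traceColours d e * 2 ^ d)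
  strongOdd-bounded = let (c , odd) = odd-colouring d in
    traceColours d e * 2 ^ d , ≤-refl , φ c odd , φ-strongOdd c odd

-- Clique-minor-free graphs and minor-closed classes

degeneracy : ℕ → ℕ
degeneracy t = 2 * 2 ^ t

oddColours : ℕ → ℕ
oddColours t = traceColours (degeneracy t) (2 * closeDensity t (degeneracy t)) * 2 ^ degeneracy t

-- Two degenerate orderings are used: the lists `back` of one for `G` serve as out-lists, and one
-- for the closure provides `κ` and the candidates for successors.
cliqueMinor-free⇒χso≤ : ∀ t (G : Graph) → ¬ CliqueMinorIn t G (allFin (n G)) → χso≤ G (oddColours t)
cliqueMinor-free⇒χso≤ t G free = Colouring.strongOdd-bounded t G free (degeneracy t) (back degenerate) (back-≤ degenerate)
  (λ {x} {y} → compare (back-edge degenerate) (listed x) (listed y)) _ ordering (proj₁ colouring) (proj₂ colouring)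
  where
  degenerate : Ordering (adj G) (degeneracy t) (allFin (n G))
  degenerate = sparse⇒ordering (sym G) (irrefl G)
    (λ X unique → cliqueMinor-free⇒sparse unique (λ k → free (widen k))) (allFin (n G)) (Unique-allFin (n G))
  compare : ∀ {xs x y} → AllPairs (λ x y → adj G x y ≡ true → y ∈ back degenerate x) xs → x ∈ xs → y ∈ xs →
            adj G x y ≡ true → y ∈ back degenerate x ⊎ x ∈ back degenerate y
  compare _ (here refl) (here refl) a = ⊥-elim (adj⇒≢ G a refl)
  compare (b ∷ _) (here refl) (there y∈) a = inj₁ (All.lookup b y∈ a)
  compare (b ∷ _) (there x∈) (here refl) a = inj₂ (All.lookup b x∈ (adj-sym G a))
  compare (_ ∷ bs) (there x∈) (there y∈) a = compare bs x∈ y∈ a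
  listed : ∀ x → x ∈ order degenerate
  listed x = ∈-resp-↭ (↭-sym (order-↭ degenerate)) (∈-allFin x)
  open Orientation t G free (degeneracy t) (back degenerate) (back-≤ degenerate)
  ordering : Ordering (simple close) (2 * closeDensity t (degeneracy t)) (allFin (n G))
  ordering = sparse⇒ordering (simple-sym close) (simple-irr close) close-sparse (allFin (n G)) (Unique-allFin (n G))
  colouring = greedy-colouring (simple-sym close) (simple-irr close) ordering

-- The graph `H` is a subgraph of the complete graph on its vertices, so the same branch sets serve.
complete-minor⇒minor : ∀ {H G} → MinorModel (complete (n H)) G → MinorModel H G
complete-minor⇒minor {H} m = record
  { branch    = MinorModel.branch m
  ; nonempty  = MinorModel.nonempty m
  ; connected = MinorModel.connected m
  ; edges     = λ h h′ a → MinorModel.edges m h h′ (simple-⁺ (λ _ _ → true) (adj⇒≢ H a) (inj₁ refl))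
  }

theorem4 : (𝒢 : GraphClass) → MinorClosed 𝒢 → Proper 𝒢 →
    ∃ λ (c : ℕ) → ∀ (G : Graph) → 𝒢 G → χso≤ G c
theorem4 𝒢 closed (H , H∉) = oddColours (n H) , λ G G∈ →
  cliqueMinor-free⇒χso≤ (n H) G λ k → H∉ (closed G H G∈ (complete-minor⇒minor (model k)))
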